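{- Let $G$ be a finite group and let $\mathfrak{X}(G)=(G,\{c_g\mid g\in G\})$ be the thin homogeneous coherent configuration defined by $G$. Let $\mathfrak{W}$ be the set of $\sim$ equivalence classes of weights on $\mathfrak{X}(G)$ having no zero entry, let $\mathfrak{W}_H$ be the set of $\sim_H$ equivalence classes of H-weights on $\mathfrak{X}(G)$ having no zero entry, and let $H^2(G,\mathbb{C}^\times)$ be the $2$-cohomology group of $G$. Then there exist natural bijections between the three sets $\mathfrak{W}$, $\mathfrak{W}_H$ and $H^2(G,\mathbb{C}^\times)$; namely, the maps $$\Phi:H^2(G,\mathbb{C}^\times)\to\mathfrak{W},\quad \Phi([\alpha])=[W_\alpha],\qquad \Psi:\mathfrak{W}_H\to\mathfrak{W},\quad \Psi([W]_H)=[W]$$ are well defined and bijective, where $[\alpha]$, $[W]$, $[W]_H$ denote the class of $\alpha$ in $H^2(G,\mathbb{C}^\times)$, the $\sim$ class of a weight $W$, and the $\sim_H$ class of an H-weight $W$.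
   Context: Let $G$ be a finite group and $M_G(\mathbb{C})$ the algebra of complex matrices with rows and columns indexed by $G$. For $g\in G$ put $c_g=\{(x,y)\in G\times G\mid xg=y\}$, $C=\{c_g\mid g\in G\}$, $\mathfrak{X}(G)=(G,C)$, and let $c_g^*=\{(y,x)\mid (x,y)\in c_g\}=c_{g^{ -1}}$. Let $A_g\in M_G(\mathbb{C})$ be the $0/1$ matrix with $(A_g)_{x,y}=1$ iff $(x,y)\in c_g$. For $W\in M_G(\mathbb{C})$ let $\mathrm{spt}(W)=\{(x,y)\mid W_{xy}\neq 0\}$ and $A_g^W=A_g\circ W$ (entrywise product). A matrix $W$ is a weight on $\mathfrak{X}(G)$ if: (W1) $\mathrm{spt}(W)$ is a union of members of $C$, and for $d\in C$, $d\subset\mathrm{spt}(W)$ implies $d^*\subset\mathrm{spt}(W)$; (W2) $W_{xx}\neq 0$ for all $x\in G$; (W3) the linear span $\bigoplus_{g\in G}\mathbb{C}A_g^W$ is an algebra (closed under matrix multiplication). It is an H-weight if moreover (W4) $W$ is hermitian, $|W_{xy}|\in\{0,1\}$ for all $x,y$, and $W_{xx}=1$ for all $x$. $W$ has no zero entry if $\mathrm{spt}(W)=G\times G$. Equivalence: let $\mathrm{Aut}(\mathfrak{X}(G))$ be the group of permutations $\sigma$ of $G$ with $c^\sigma=c$ for all $c\in C$, where $c^\sigma=\{(x^\sigma,y^\sigma)\mid(x,y)\in c\}$, and let $P_\sigma$ be the permutation matrix of $\sigma$. Weights $W,W'$ are equivalent, $W\sim W'$, if there exist $a_x\in\mathbb{C}^\times$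 ($x\in G$), $\gamma(g)\in\mathbb{C}^\times$ ($g\in G$) and $\sigma\in\mathrm{Aut}(\mathfrak{X}(G))$ with $$W'=\mathrm{diag}(a_x\mid x\in G)^{ -1}P_\sigma^{ -1}\Big(\sum_{g\in G}\gamma(g)A_g^W\Big)P_\sigma\,\mathrm{diag}(a_x\mid x\in G).$$ H-weights $W,W'$ are H-equivalent, $W\sim_H W'$, if this holds with $|a_x|=|\gamma(g)|=1$ for all $x,g$ and $\gamma(g^{ -1})=\gamma(g)^{ -1}$ for all $g$. A factor set ($2$-cocycle) is a function $\alpha:G\times G\to\mathbb{C}^\times$ with $\alpha(g,h)\alpha(gh,k)=\alpha(g,hk)\alpha(h,k)$ for all $g,h,k\in G$ (trivial action). Factor sets $\alpha,\beta$ are equivalent if there is $\gamma:G\to\mathbb{C}^\times$ with $\beta(g,h)=\gamma(g)\gamma(h)\gamma(gh)^{ -1}\alpha(g,h)$ for all $g,h$. $H^2(G,\mathbb{C}^\times)$ is the group of factor sets modulo this equivalence (i.e. modulo $2$-coboundaries). For a factor set $\alpha$, $W_\alpha\in M_G(\mathbb{C})$ is defined by $(W_\alpha)_{xy}=\alpha(x,x^{ -1}y)$. -}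

module Defs where

open import Algebra.Bundles using (CommutativeRing; Group)
open import Algebra.Bundles.Raw using (RawMonoid)
import Algebra.Definitions.RawMonoid as RawMonoidDefs
open import Data.Bool.Base using (if_then_else_)
open import Data.Fin.Base using (Fin)
import Data.Fin.Properties as Fin
open import Data.Nat.Base using (ℕ)
open import Data.Product.Base using (_×_; _,_; ∃; ∃-syntax; Σ-syntax; proj₁)
open import Data.Sum.Base using (_⊎_)
open import Function.Base using (_on_; flip)
open import Function.Bundles using (Inverse)
open import Level using (Level; _⊔_; suc)
open import Relation.Binary.Core using (Rel; _⇒_; _⇔_; _Preserves_⟶_; _Preserves₂_⟶_⟶_)
open import Relation.Binary.Definitions using (Decidable)
open import Relation.Binary.Structures using (IsStrictTotalOrder)
open import Relation.Binary.PropositionalEquality as ≡ using (_≡_)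
open import Relation.Nullary using (Dec; yes; no; does; ¬_)
open import Relation.Nullary.Decidable using (map′)
open import Relation.Unary using (Pred)

-- The real numbers enter through their classical characterisation, which
-- determines them up to a unique isomorphism: a totally ordered field in which
-- every inhabited subset with an upper bound has a least upper bound.  The
-- classical content is in the trichotomy of `isStrictTotalOrder` and in
-- `supremum`.

record CompleteOrderedField (c ℓ₁ ℓ₂ : Level) : Set (suc (c ⊔ ℓ₁ ⊔ ℓ₂)) where
  infix 4 _<_ _≤_
  field
    commutativeRing : CommutativeRing c ℓ₁

  open CommutativeRing commutativeRing public

  field
    0≉1                : ¬ (0# ≈ 1#)
    inverse            : ∀ {x} → ¬ (x ≈ 0#) → ∃[ y ] x * y ≈ 1#
    _<_                : Rel Carrier ℓ₂
    isStrictTotalOrder : IsStrictTotalOrder _≈_ _<_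
    +-monoˡ-<          : ∀ z {x y} → x < y → x + z < y + z
    *-pos              : ∀ {x y} → 0# < x → 0# < y → 0# < x * y

  open IsStrictTotalOrder isStrictTotalOrder public using (_≟_; compare)

  _≤_ : Rel Carrier (ℓ₁ ⊔ ℓ₂)
  x ≤ y = x < y ⊎ x ≈ y

  UpperBound : ∀ {p} → Pred Carrier p → Pred Carrier (c ⊔ ℓ₁ ⊔ ℓ₂ ⊔ p)
  UpperBound P u = ∀ x → P x → x ≤ u

  field
    supremum : (P : Pred Carrier (c ⊔ ℓ₁ ⊔ ℓ₂)) → ∃ P → ∃ (UpperBound P) →
               ∃[ s ] UpperBound P s × (∀ u → UpperBound P u → s ≤ u)

  -- Total, with the convention 0⁻¹ = 0.
  infix 8 _⁻¹
  _⁻¹ : Carrier → Carrier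
  x ⁻¹ with x ≟ 0#
  ... | yes _   = 0#
  ... | no x≉0  = proj₁ (inverse x≉0)

module Complex {c ℓ₁ ℓ₂} (ℝ : CompleteOrderedField c ℓ₁ ℓ₂) where

  private module ℝ = CompleteOrderedField ℝ

  infix  4 _≈_ _≉_
  infixl 6 _+_
  infixl 7 _*_
  infix  8 _⁻¹

  record ℂ : Set c where
    constructor _+i_
    field
      re im : ℝ.Carrier

  open ℂ public

  _≈_ _≉_ : Rel ℂ ℓ₁
  z ≈ w = (re z ℝ.≈ re w) × (im z ℝ.≈ im w)
  z ≉ w = ¬ (z ≈ w)

  0ℂ 1ℂ : ℂ
  0ℂ = ℝ.0# +i ℝ.0#
  1ℂ = ℝ.1# +i ℝ.0#

  _+_ _*_ : ℂ → ℂ → ℂ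
  z + w = (re z ℝ.+ re w) +i (im z ℝ.+ im w)
  z * w = (re z ℝ.* re w ℝ.- im z ℝ.* im w) +i (re z ℝ.* im w ℝ.+ im z ℝ.* re w)

  conj : ℂ → ℂ
  conj z = re z +i (ℝ.- im z)

  normSq : ℂ → ℝ.Carrier
  normSq z = re z ℝ.* re z ℝ.+ im z ℝ.* im z

  -- Total, with the convention 0⁻¹ = 0.
  _⁻¹ : ℂ → ℂ
  z ⁻¹ = (re z ℝ.* normSq z ℝ.⁻¹) +i ((ℝ.- im z) ℝ.* normSq z ℝ.⁻¹)

  -- |z| = r, that is, r is the non-negative square root of re² + im².
  HasModulus : ℂ → ℝ.Carrier → Set (ℓ₁ ⊔ ℓ₂)
  HasModulus z r = (ℝ.0# ℝ.≤ r) × (r ℝ.* r ℝ.≈ normSq z)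

  +-rawMonoid : RawMonoid c ℓ₁
  +-rawMonoid = record { Carrier = ℂ ; _≈_ = _≈_ ; _∙_ = _+_ ; ε = 0ℂ }

  open RawMonoidDefs +-rawMonoid public using (sum)

record FiniteGroup (c ℓ : Level) : Set (suc (c ⊔ ℓ)) where
  field
    group       : Group c ℓ
    order       : ℕ
    enumeration : Inverse (Group.setoid group) (≡.setoid (Fin order))

  open Group group public

  elementAt : Fin order → Carrier
  elementAt = Inverse.from enumeration

  infix 4 _≟_
  _≟_ : Decidable _≈_
  x ≟ y = map′ injective (Inverse.to-cong enumeration)
               (Inverse.to enumeration x Fin.≟ Inverse.to enumeration y)
    where
    injective : Inverse.to enumeration x ≡ Inverse.to enumeration y → x ≈ y
    injective eq = trans (sym (Inverse.strictlyInverseʳ enumeration x))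
      (trans (Inverse.from-cong enumeration eq) (Inverse.strictlyInverseʳ enumeration y))

module ThinConfiguration
  {r ℓr₁ ℓr₂ g ℓg} (ℝ : CompleteOrderedField r ℓr₁ ℓr₂) (𝔾 : FiniteGroup g ℓg) where

  private module ℝ = CompleteOrderedField ℝ
  open Complex ℝ
  private module G = FiniteGroup 𝔾
  open G using (_∙_) renaming (Carrier to G)

  Σᴳ : (G → ℂ) → ℂ
  Σᴳ f = sum (λ i → f (G.elementAt i))

  -- Since G is a setoid, a function on G has to respect its equality; for the
  -- matrices below this is required whenever it does not hold by construction.

  record ℂˣ-Valued : Set (r ⊔ ℓr₁ ⊔ g ⊔ ℓg) where
    field
      value   : G → ℂ
      cong    : value Preserves G._≈_ ⟶ _≈_
      nonzero : ∀ x → value x ≉ 0ℂ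

  open ℂˣ-Valued public using (value)

  Unimodular : ℂˣ-Valued → Set (ℓr₁ ⊔ ℓr₂ ⊔ g)
  Unimodular a = ∀ x → HasModulus (value a x) ℝ.1#

  c : G → Rel G ℓg
  c h x y = x ∙ h G.≈ y

  Permutation : Set (g ⊔ ℓg)
  Permutation = Inverse G.setoid G.setoid

  _^_ : ∀ {ℓ} → Rel G ℓ → Permutation → Rel G (g ⊔ ℓg ⊔ ℓ)
  (d ^ σ) u v = ∃[ x ] ∃[ y ] d x y × Inverse.to σ x G.≈ u × Inverse.to σ y G.≈ v

  IsAutomorphism : Permutation → Set (g ⊔ ℓg)
  IsAutomorphism σ = ∀ h → (c h ^ σ) ⇔ c h

  Matrix : Set (r ⊔ g)
  Matrix = G → G → ℂ

  infix 4 _≈ᴹ_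
  _≈ᴹ_ : Rel Matrix (ℓr₁ ⊔ g)
  M ≈ᴹ N = ∀ x y → M x y ≈ N x y

  infixl 7 _⊗_ _∘_
  _⊗_ _∘_ : Matrix → Matrix → Matrix
  (M ⊗ N) x y = Σᴳ (λ z → M x z * N z y)
  (M ∘ N) x y = M x y * N x y

  indicator : ∀ {p} {P : Set p} → Dec P → ℂ
  indicator P? = if does P? then 1ℂ else 0ℂ

  A : G → Matrix
  A h x y = indicator (x ∙ h G.≟ y)

  A[_]_ : Matrix → G → Matrix
  A[ W ] h = A h ∘ W

  -- Σ_{h ∈ G} γ(h) A_h^W
  combination : (G → ℂ) → Matrix → Matrix
  combination γ W x y = Σᴳ (λ h → γ h * (A[ W ] h) x y)

  diag : (G → ℂ) → Matrix
  diag a x y = indicator (x G.≟ y) * a x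

  -- With permutations acting on the right, (P_σ)_{x,y} = 1 iff x^σ = y, so that
  -- P_σ⁻¹ A_d P_σ is the adjacency matrix of d^σ, for any relation d on G.
  P : Permutation → Matrix
  P σ x y = indicator (Inverse.to σ x G.≟ y)

  -- P_σ⁻¹ = P_{σ⁻¹}
  P⁻¹ : Permutation → Matrix
  P⁻¹ σ x y = indicator (Inverse.from σ x G.≟ y)

  spt : Matrix → Rel G ℓr₁
  spt W x y = W x y ≉ 0ℂ

  ⋃ : ∀ {s} → Pred G s → Rel G (g ⊔ ℓg ⊔ s)
  ⋃ S x y = ∃[ h ] S h × c h x y

  InSpan : Matrix → Pred Matrix (r ⊔ ℓr₁ ⊔ g ⊔ ℓg)
  InSpan W M = Σ[ γ ∈ (G → ℂ) ] γ Preserves G._≈_ ⟶ _≈_ × M ≈ᴹ combination γ W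

  record IsWeight (W : Matrix) : Set (r ⊔ suc ℓr₁ ⊔ g ⊔ ℓg) where
    field
      cong       : W Preserves₂ G._≈_ ⟶ G._≈_ ⟶ _≈_
      sptUnion   : Σ[ S ∈ Pred G ℓr₁ ] spt W ⇔ ⋃ S
      sptSym     : ∀ h → c h ⇒ spt W → flip (c h) ⇒ spt W
      diagonal   : ∀ x → W x x ≉ 0ℂ
      spanClosed : ∀ {M N} → InSpan W M → InSpan W N → InSpan W (M ⊗ N)

  record IsHWeight (W : Matrix) : Set (r ⊔ suc ℓr₁ ⊔ ℓr₂ ⊔ g ⊔ ℓg) where
    field
      isWeight  : IsWeight W
      hermitian : ∀ x y → W y x ≈ conj (W x y)
      modulus   : ∀ x y → HasModulus (W x y) ℝ.0# ⊎ HasModulus (W x y) ℝ.1#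
      diagonal₁ : ∀ x → W x x ≈ 1ℂ

  NoZeroEntry : Matrix → Set (ℓr₁ ⊔ g)
  NoZeroEntry W = ∀ x y → spt W x y

  transform : ℂˣ-Valued → ℂˣ-Valued → Permutation → Matrix → Matrix
  transform a γ σ W =
    diag (λ x → value a x ⁻¹) ⊗ P⁻¹ σ ⊗ combination (value γ) W ⊗ P σ ⊗ diag (value a)

  _≈ᵂ_ : Rel Matrix (r ⊔ ℓr₁ ⊔ g ⊔ ℓg)
  W ≈ᵂ W′ = Σ[ a ∈ ℂˣ-Valued ] Σ[ γ ∈ ℂˣ-Valued ] Σ[ σ ∈ Permutation ]
    IsAutomorphism σ × W′ ≈ᴹ transform a γ σ W

  _≈ᴴ_ : Rel Matrix (r ⊔ ℓr₁ ⊔ ℓr₂ ⊔ g ⊔ ℓg)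
  W ≈ᴴ W′ = Σ[ a ∈ ℂˣ-Valued ] Σ[ γ ∈ ℂˣ-Valued ] Σ[ σ ∈ Permutation ]
    IsAutomorphism σ × W′ ≈ᴹ transform a γ σ W ×
    Unimodular a × Unimodular γ × (∀ h → value γ (h G.⁻¹) ≈ value γ h ⁻¹)

  record IsFactorSet (α : G → G → ℂ) : Set (ℓr₁ ⊔ g ⊔ ℓg) where
    field
      cong    : α Preserves₂ G._≈_ ⟶ G._≈_ ⟶ _≈_
      nonzero : ∀ h k → α h k ≉ 0ℂ
      cocycle : ∀ h k l → α h k * α (h ∙ k) l ≈ α h (k ∙ l) * α k l

  W[_] : (G → G → ℂ) → Matrix
  W[ α ] x y = α x (x G.⁻¹ ∙ y)

  -- The quotient sets H²(G,ℂˣ), 𝔚 and 𝔚_H are represented by the types of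
  -- representatives FactorSet, Weight, HWeight with the relations _∼²_, _∼_, _∼ᴴ_.

  FactorSet : Set (r ⊔ ℓr₁ ⊔ g ⊔ ℓg)
  FactorSet = ∃ IsFactorSet

  Weight : Set (r ⊔ suc ℓr₁ ⊔ g ⊔ ℓg)
  Weight = Σ[ W ∈ Matrix ] IsWeight W × NoZeroEntry W

  HWeight : Set (r ⊔ suc ℓr₁ ⊔ ℓr₂ ⊔ g ⊔ ℓg)
  HWeight = Σ[ W ∈ Matrix ] IsHWeight W × NoZeroEntry W

  infix 4 _≈ᵂ_ _≈ᴴ_ _∼²_ _∼_ _∼ᴴ_

  _∼²_ : Rel FactorSet (r ⊔ ℓr₁ ⊔ g ⊔ ℓg)
  (α , _) ∼² (β , _) = Σ[ γ ∈ ℂˣ-Valued ]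
    ∀ h k → β h k ≈ value γ h * value γ k * value γ (h ∙ k) ⁻¹ * α h k

  _∼_ : Rel Weight (r ⊔ ℓr₁ ⊔ g ⊔ ℓg)
  _∼_ = _≈ᵂ_ on proj₁

  _∼ᴴ_ : Rel HWeight (r ⊔ ℓr₁ ⊔ ℓr₂ ⊔ g ⊔ ℓg)
  _∼ᴴ_ = _≈ᴴ_ on proj₁

  Ψ : HWeight → Weight
  Ψ (W , isHWeight , noZero) = W , IsHWeight.isWeight isHWeight , noZero

{-# OPTIONS --safe #-}

-- A matrix V without zero entries is a weight iff it is twisted by some α : G × G → ℂˣ, meaning
-- V(x,xh) V(xh,xhk) = α(h,k) V(x,xhk) for all x: this is closure of the span on the products of the
-- basis matrices.  Such an α is a cocycle, and x = 1 exhibits V as a gauge transform of W_α.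
-- Automorphisms of the configuration are left translations, and these change W_α only by a gauge.
-- For H-weights, taking products over G shows that ℝ₊-valued multipliers are trivial: a gauge
-- transformation between H-weights has |γ(h)|^|G| = 1, and |α|^|G| is the coboundary of ∏ₗ |α(h,l)|,
-- so every cocycle becomes unimodular after extracting |G|-th roots.  Square roots of unimodular
-- numbers then make the weight hermitian.
module Submission where

open import Algebra.Bundles using (AbelianGroup; CommutativeMonoid; CommutativeRing; CommutativeSemiring; Group)
open import Data.Empty using (⊥; ⊥-elim)
open import Data.Fin.Base using (Fin; punchIn)
open import Data.Fin.Properties using (punchInᵢ≢i)
open import Data.Nat.Base using (ℕ; zero; suc; NonZero)
open import Data.Product.Base using (_×_; _,_; proj₁; proj₂; ∃; ∃-syntax; Σ-syntax)
open import Data.Sum.Base using (_⊎_; inj₁; inj₂)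
open import Data.Vec.Base as Vec using (Vec; []; _∷_)
open import Data.Vec.N-ary using (N-ary; _$ⁿ_)
open import Function.Bundles using (Inverse)
open import Function.Structures using (IsBijection)
open import Level using (_⊔_; Lift; lift)
open import Relation.Binary.Bundles using (StrictTotalOrder)
open import Relation.Binary.Core using (Rel; _Preserves_⟶_)
open import Relation.Binary.Definitions using (Trichotomous; Tri; tri<; tri≈; tri>)
open import Relation.Binary.PropositionalEquality as ≡ using (_≡_; _≢_)
open import Relation.Binary.Structures using (IsEquivalence; IsStrictTotalOrder)
open import Relation.Nullary using (¬_; Dec; yes; no)
import Algebra.Properties.AbelianGroup as AbelianGroupProperties
import Algebra.Properties.CommutativeMonoid.Mult as Mult
import Algebra.Properties.CommutativeMonoid.Sum as Sum
import Algebra.Properties.CommutativeSemigroup as CommutativeSemigroupProperties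
import Algebra.Properties.Group as GroupProperties
import Algebra.Properties.Semiring.Sum as SemiringSum
import Algebra.Solver.CommutativeMonoid as MonoidSolver
import Algebra.Solver.CommutativeMonoid.Normal as MonoidNormal
import Algebra.Solver.Ring.NaturalCoefficients.Default as SemiringSolver
import Relation.Binary.Construct.StrictToNonStrict as StrictToNonStrict
import Relation.Binary.Reasoning.Setoid as SetoidReasoning
open import Defs

-- Matrices without zero entries have entries in an abelian group. Apart from closure of the span,
-- where sums occur, the arguments therefore reduce to identities between monomials over ℂˣ or ℝ₊.
-- The analytic input is confined to n-th roots in ℝ₊ and square roots on the unit circle. Because G
-- is a setoid, every function on it has to respect its equality. This is why α is read off from V
-- as V(1,h) V(h,hk) / V(1,hk) rather than taken from the coefficients that closure supplies, why
-- the square root is an explicit branch, and why roots indexed by G are chosen at canonical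
-- representatives. The branch also settles hermitian symmetry. It prescribes γ(h) γ(h⁻¹), a value
-- symmetric in h and h⁻¹; a single-valued root gives both the same value, so G need not be split
-- into inverse pairs, and √1 = 1 keeps the diagonal equal to 1. An equivalence between two
-- H-weights is already almost an H-equivalence: its γ has modulus 1, |b| is constant, and division
-- by b(1) changes nothing because b enters as b(x)⁻¹ b(y).

-- Equation solvers for abelian groups and commutative rings.

-- An equation of fractions is an equation of monoid expressions after
-- cross-multiplication.
module AbelianGroupSolver {c ℓ} (A : AbelianGroup c ℓ) where

  open AbelianGroup A
  open AbelianGroupProperties A using (∙-cancelʳ)
  private module M = MonoidSolver commutativeMonoid
  open M using (Expr)
  open MonoidNormal commutativeMonoid using (correct)
  open SetoidReasoning setoid

  infixl 7 _⊕_
  infixl 7 _⊖_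

  data Term (n : ℕ) : Set where
    var : Fin n → Term n
    one : Term n
    _⊕_ : Term n → Term n → Term n
    inv : Term n → Term n

  _⊖_ : ∀ {n} → Term n → Term n → Term n
  s ⊖ t = s ⊕ inv t

  ⟦_⟧ : ∀ {n} → Term n → Vec Carrier n → Carrier
  ⟦ var i ⟧ ρ = Vec.lookup ρ i
  ⟦ one ⟧ ρ   = ε
  ⟦ s ⊕ t ⟧ ρ = ⟦ s ⟧ ρ ∙ ⟦ t ⟧ ρ
  ⟦ inv t ⟧ ρ = ⟦ t ⟧ ρ ⁻¹

  numerator denominator : ∀ {n} → Term n → Expr n
  numerator (var i) = M.var i
  numerator one     = M.id
  numerator (s ⊕ t) = numerator s M.⊕ numerator t
  numerator (inv t) = denominator t
  denominator (var i) = M.id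
  denominator one     = M.id
  denominator (s ⊕ t) = denominator s M.⊕ denominator t
  denominator (inv t) = numerator t

  private
    interchange : ∀ x y z w → (x ∙ y) ∙ (z ∙ w) ≈ (x ∙ z) ∙ (y ∙ w)
    interchange = M.solve 4 (λ x y z w →
      (x M.⊕ y) M.⊕ (z M.⊕ w) M.⊜ (x M.⊕ z) M.⊕ (y M.⊕ w)) refl

  fraction : ∀ {n} (t : Term n) ρ → ⟦ t ⟧ ρ ∙ M.⟦ denominator t ⟧ ρ ≈ M.⟦ numerator t ⟧ ρ
  fraction (var i) ρ = identityʳ _
  fraction one     ρ = identityʳ _
  fraction (s ⊕ t) ρ = trans (interchange _ _ _ _) (∙-cong (fraction s ρ) (fraction t ρ))
  fraction (inv t) ρ = begin
    ⟦ t ⟧ ρ ⁻¹ ∙ M.⟦ numerator t ⟧ ρ                    ≈⟨ ∙-congˡ (fraction t ρ) ⟨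
    ⟦ t ⟧ ρ ⁻¹ ∙ (⟦ t ⟧ ρ ∙ M.⟦ denominator t ⟧ ρ)      ≈⟨ assoc _ _ _ ⟨
    (⟦ t ⟧ ρ ⁻¹ ∙ ⟦ t ⟧ ρ) ∙ M.⟦ denominator t ⟧ ρ      ≈⟨ ∙-congʳ (inverseˡ _) ⟩
    ε ∙ M.⟦ denominator t ⟧ ρ                           ≈⟨ identityˡ _ ⟩
    M.⟦ denominator t ⟧ ρ                               ∎

  private
    cross : ∀ {n} (s t : Term n) ρ → (⟦ s ⟧ ρ ∙ M.⟦ denominator s ⟧ ρ) ∙ M.⟦ denominator t ⟧ ρ
            ≈ M.⟦ numerator s M.⊕ denominator t ⟧ ρ
    cross s t ρ = ∙-congʳ (fraction s ρ)

  -- Normal forms are exponent vectors and evaluate on concrete terms, so callers discharge the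
  -- hypothesis by `≡.refl`.
  prove : ∀ {n} (s t : Term n) →
          M.normalise (numerator s M.⊕ denominator t) ≡ M.normalise (numerator t M.⊕ denominator s) →
          ∀ ρ → ⟦ s ⟧ ρ ≈ ⟦ t ⟧ ρ
  prove s t eq ρ = ∙-cancelʳ (M.⟦ denominator s ⟧ ρ ∙ M.⟦ denominator t ⟧ ρ) _ _ (begin
    ⟦ s ⟧ ρ ∙ (M.⟦ denominator s ⟧ ρ ∙ M.⟦ denominator t ⟧ ρ)   ≈⟨ assoc _ _ _ ⟨
    ⟦ s ⟧ ρ ∙ M.⟦ denominator s ⟧ ρ ∙ M.⟦ denominator t ⟧ ρ     ≈⟨ cross s t ρ ⟩
    M.⟦ numerator s M.⊕ denominator t ⟧ ρ                       ≈⟨ correct (numerator s M.⊕ denominator t) ρ ⟨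
    M.⟦ M.normalise (numerator s M.⊕ denominator t) ⟧⇓ ρ        ≡⟨ ≡.cong (λ v → M.⟦ v ⟧⇓ ρ) eq ⟩
    M.⟦ M.normalise (numerator t M.⊕ denominator s) ⟧⇓ ρ        ≈⟨ correct (numerator t M.⊕ denominator s) ρ ⟩
    M.⟦ numerator t M.⊕ denominator s ⟧ ρ                       ≈⟨ cross t s ρ ⟨
    ⟦ t ⟧ ρ ∙ M.⟦ denominator t ⟧ ρ ∙ M.⟦ denominator s ⟧ ρ     ≈⟨ assoc _ _ _ ⟩
    ⟦ t ⟧ ρ ∙ (M.⟦ denominator t ⟧ ρ ∙ M.⟦ denominator s ⟧ ρ)   ≈⟨ ∙-congˡ (comm _ _) ⟩
    ⟦ t ⟧ ρ ∙ (M.⟦ denominator s ⟧ ρ ∙ M.⟦ denominator t ⟧ ρ)   ∎)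

  vars : ∀ {n} → Vec (Term n) n
  vars = Vec.map var (Vec.allFin _)

  module _ n (f : N-ary n (Term n) (Term n × Term n)) where

    private
      s = proj₁ (f $ⁿ vars)
      t = proj₂ (f $ⁿ vars)

    solve : M.normalise (numerator s M.⊕ denominator t) ≡ M.normalise (numerator t M.⊕ denominator s) →
            ∀ ρ → ⟦ s ⟧ ρ ≈ ⟦ t ⟧ ρ
    solve = prove s t

  module _ n (f : N-ary n (Term n) ((Term n × Term n) × (Term n × Term n))) where

    private
      l = proj₁ (proj₁ (f $ⁿ vars))
      r = proj₂ (proj₁ (f $ⁿ vars))
      s = proj₁ (proj₂ (f $ⁿ vars))
      t = proj₂ (proj₂ (f $ⁿ vars))
      s′ = s ⊕ r
      t′ = t ⊕ l

    -- Derives s ≈ t from l ≈ r when s/t and l/r are the same monomial.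
    solveFrom : M.normalise (numerator s′ M.⊕ denominator t′) ≡ M.normalise (numerator t′ M.⊕ denominator s′) →
                ∀ ρ → ⟦ l ⟧ ρ ≈ ⟦ r ⟧ ρ → ⟦ s ⟧ ρ ≈ ⟦ t ⟧ ρ
    solveFrom eq ρ l≈r = ∙-cancelʳ (⟦ r ⟧ ρ) _ _ (trans (prove s′ t′ eq ρ) (∙-congˡ l≈r))

-- An equation of differences is an equation of semiring expressions after
-- moving the subtracted terms to the other side.
module RingSolver {c ℓ} (R : CommutativeRing c ℓ) where

  open CommutativeRing R
  open AbelianGroupProperties +-abelianGroup using () renaming (∙-cancelʳ to +-cancelʳ)
  private module S = SemiringSolver commutativeSemiring
  open S using (Polynomial)
  open SetoidReasoning setoid

  infixl 6 _⊕_ _⊝_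
  infixl 7 _⊗_
  infix  8 ⊝_

  data Term (n : ℕ) : Set where
    var     : Fin n → Term n
    con     : ℕ → Term n
    _⊕_ _⊗_ : Term n → Term n → Term n
    ⊝_      : Term n → Term n

  _⊝_ : ∀ {n} → Term n → Term n → Term n
  s ⊝ t = s ⊕ ⊝ t

  ⟦_⟧ : ∀ {n} → Term n → Vec Carrier n → Carrier
  ⟦ var i ⟧ ρ = Vec.lookup ρ i
  ⟦ con k ⟧ ρ = S.⟦ S.con k ⟧ ρ
  ⟦ s ⊕ t ⟧ ρ = ⟦ s ⟧ ρ + ⟦ t ⟧ ρ
  ⟦ s ⊗ t ⟧ ρ = ⟦ s ⟧ ρ * ⟦ t ⟧ ρ
  ⟦ ⊝ t ⟧ ρ   = - ⟦ t ⟧ ρ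

  -- Formal differences, as in the Grothendieck ring of a semiring: (p - m)(q - n) = (pq + mn) - (pn
  -- + mq).
  plus minus : ∀ {n} → Term n → Polynomial n
  plus (var i) = S.var i
  plus (con k) = S.con k
  plus (s ⊕ t) = plus s S.:+ plus t
  plus (s ⊗ t) = plus s S.:* plus t S.:+ minus s S.:* minus t
  plus (⊝ t)   = minus t
  minus (var i) = S.con 0
  minus (con k) = S.con 0
  minus (s ⊕ t) = minus s S.:+ minus t
  minus (s ⊗ t) = plus s S.:* minus t S.:+ minus s S.:* plus t
  minus (⊝ t)   = plus t

  difference : ∀ {n} (t : Term n) ρ → ⟦ t ⟧ ρ + S.⟦ minus t ⟧ ρ ≈ S.⟦ plus t ⟧ ρ
  difference (var i) ρ = +-identityʳ _
  difference (con k) ρ = +-identityʳ _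
  difference (s ⊕ t) ρ = trans
    (S.solve 4 (λ x y z w → (x S.:+ y) S.:+ (z S.:+ w) S.:= (x S.:+ z) S.:+ (y S.:+ w)) refl _ _ _ _)
    (+-cong (difference s ρ) (difference t ρ))
  difference (s ⊗ t) ρ = begin
    -- With p = x + m and q = y + n the claim xy + (pn + mq) = pq + mn contains no subtraction, so
    -- the semiring solver applies.
    x * y + (S.⟦ plus s ⟧ ρ * n + m * S.⟦ plus t ⟧ ρ)           ≈⟨ +-congˡ (+-cong (*-congʳ (difference s ρ)) (*-congˡ (difference t ρ))) ⟨
    x * y + ((x + m) * n + m * (y + n))                         ≈⟨ S.solve 4 (λ x m y n →
      x S.:* y S.:+ ((x S.:+ m) S.:* n S.:+ m S.:* (y S.:+ n)) S.:= (x S.:+ m) S.:* (y S.:+ n) S.:+ m S.:* n) refl x m y n ⟩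
    (x + m) * (y + n) + m * n                                   ≈⟨ +-congʳ (*-cong (difference s ρ) (difference t ρ)) ⟩
    S.⟦ plus s ⟧ ρ * S.⟦ plus t ⟧ ρ + m * n                     ∎
    where
    x = ⟦ s ⟧ ρ
    m = S.⟦ minus s ⟧ ρ
    y = ⟦ t ⟧ ρ
    n = S.⟦ minus t ⟧ ρ
  difference (⊝ t) ρ = begin
    - ⟦ t ⟧ ρ + S.⟦ plus t ⟧ ρ                  ≈⟨ +-congˡ (difference t ρ) ⟨
    - ⟦ t ⟧ ρ + (⟦ t ⟧ ρ + S.⟦ minus t ⟧ ρ)     ≈⟨ +-assoc _ _ _ ⟨
    - ⟦ t ⟧ ρ + ⟦ t ⟧ ρ + S.⟦ minus t ⟧ ρ       ≈⟨ +-congʳ (-‿inverseˡ _) ⟩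
    0# + S.⟦ minus t ⟧ ρ                        ≈⟨ +-identityˡ _ ⟩
    S.⟦ minus t ⟧ ρ                             ∎

  vars : ∀ {n} → Vec (Term n) n
  vars = Vec.map var (Vec.allFin _)

  module _ n (f : N-ary n (Term n) (Term n × Term n)) where

    private
      s = proj₁ (f $ⁿ vars)
      t = proj₂ (f $ⁿ vars)

    solve : (∀ ρ → S.⟦ plus s S.:+ minus t ⟧↓ ρ ≈ S.⟦ plus t S.:+ minus s ⟧↓ ρ) →
            ∀ ρ → ⟦ s ⟧ ρ ≈ ⟦ t ⟧ ρ
    solve eq ρ = +-cancelʳ (S.⟦ minus s ⟧ ρ + S.⟦ minus t ⟧ ρ) _ _ (begin
      ⟦ s ⟧ ρ + (S.⟦ minus s ⟧ ρ + S.⟦ minus t ⟧ ρ)   ≈⟨ +-assoc _ _ _ ⟨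
      ⟦ s ⟧ ρ + S.⟦ minus s ⟧ ρ + S.⟦ minus t ⟧ ρ     ≈⟨ +-congʳ (difference s ρ) ⟩
      S.⟦ plus s S.:+ minus t ⟧ ρ                     ≈⟨ S.prove ρ (plus s S.:+ minus t) (plus t S.:+ minus s) (eq ρ) ⟩
      S.⟦ plus t S.:+ minus s ⟧ ρ                     ≈⟨ +-congʳ (difference t ρ) ⟨
      ⟦ t ⟧ ρ + S.⟦ minus t ⟧ ρ + S.⟦ minus s ⟧ ρ     ≈⟨ +-assoc _ _ _ ⟩
      ⟦ t ⟧ ρ + (S.⟦ minus t ⟧ ρ + S.⟦ minus s ⟧ ρ)   ≈⟨ +-congˡ (+-comm _ _) ⟩
      ⟦ t ⟧ ρ + (S.⟦ minus s ⟧ ρ + S.⟦ minus t ⟧ ρ)   ∎)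

-- Ordered fields and the group of positive reals.

module StrictTotalOrderProperties {c ℓ₁ ℓ₂} (O : StrictTotalOrder c ℓ₁ ℓ₂) where

  open StrictTotalOrder O
  private module ≤ = StrictToNonStrict _≈_ _<_
  open ≤ public using (_≤_)

  <-≤-trans : ∀ {x y z} → x < y → y ≤ z → x < z
  <-≤-trans = ≤.<-≤-trans trans <-respʳ-≈

  ≤-<-trans : ∀ {x y z} → x ≤ y → y < z → x < z
  ≤-<-trans = ≤.≤-<-trans Eq.sym trans <-respˡ-≈

  ≤-trans : ∀ {x y z} → x ≤ y → y ≤ z → x ≤ z
  ≤-trans = ≤.trans Eq.isEquivalence (<-respʳ-≈ , <-respˡ-≈) trans

  ≮⇒≥ : ∀ {x y} → ¬ x < y → y ≤ x
  ≮⇒≥ {x} {y} x≮y with compare x y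
  ... | tri< x<y _ _ = ⊥-elim (x≮y x<y)
  ... | tri≈ _ x≈y _ = inj₂ (Eq.sym x≈y)
  ... | tri> _ _ x>y = inj₁ x>y

  <⇒≱ : ∀ {x y} → x < y → ¬ y ≤ x
  <⇒≱ x<y y≤x = irrefl Eq.refl (<-≤-trans x<y y≤x)

module OrderedField {c ℓ₁ ℓ₂} (ℝ : CompleteOrderedField c ℓ₁ ℓ₂) where

  open CompleteOrderedField ℝ
  open IsStrictTotalOrder isStrictTotalOrder public
    using (<-respˡ-≈; <-respʳ-≈) renaming (irrefl to <-irrefl; trans to <-trans)

  ℝ-order : StrictTotalOrder c ℓ₁ ℓ₂
  ℝ-order = record { isStrictTotalOrder = isStrictTotalOrder }

  open StrictTotalOrderProperties ℝ-order public hiding (_≤_)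
  open RingSolver commutativeRing

  <⇒≉ : ∀ {x y} → x < y → ¬ y ≈ x
  <⇒≉ x<y y≈x = <-irrefl (sym y≈x) x<y

  +-mono-< : ∀ {x y z w} → x < y → z < w → x + z < y + w
  +-mono-< {x} {y} {z} {w} x<y z<w = <-trans (+-monoˡ-< z x<y)
    (<-respˡ-≈ (+-comm z y) (<-respʳ-≈ (+-comm w y) (+-monoˡ-< y z<w)))

  x<y⇒0<y-x : ∀ {x y} → x < y → 0# < y - x
  x<y⇒0<y-x {x} x<y = <-respˡ-≈ (-‿inverseʳ x) (+-monoˡ-< (- x) x<y)

  0<y-x⇒x<y : ∀ {x y} → 0# < y - x → x < y
  0<y-x⇒x<y {x} {y} 0<y-x = <-respˡ-≈ (+-identityˡ x)
    (<-respʳ-≈ (solve 2 (λ x y → (y ⊝ x) ⊕ x , y) (λ _ → refl) (x ∷ y ∷ [])) (+-monoˡ-< x 0<y-x))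

  x≤x+y : ∀ {x y} → 0# ≤ y → x ≤ x + y
  x≤x+y (inj₁ 0<y) = inj₁ (<-respˡ-≈ (+-identityˡ _) (<-respʳ-≈ (+-comm _ _) (+-monoˡ-< _ 0<y)))
  x≤x+y (inj₂ 0≈y) = inj₂ (trans (sym (+-identityʳ _)) (+-congˡ 0≈y))

  x<0⇒0<-x : ∀ {x} → x < 0# → 0# < - x
  x<0⇒0<-x x<0 = <-respʳ-≈ (+-identityˡ _) (x<y⇒0<y-x x<0)

  *-monoˡ-< : ∀ {x y z} → 0# < z → x < y → x * z < y * z
  *-monoˡ-< {x} {y} {z} 0<z x<y = 0<y-x⇒x<y (<-respʳ-≈
    (solve 3 (λ x y z → (y ⊝ x) ⊗ z , y ⊗ z ⊝ x ⊗ z) (λ _ → refl) (x ∷ y ∷ z ∷ []))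
    (*-pos (x<y⇒0<y-x x<y) 0<z))

  0≤x² : ∀ x → 0# ≤ x * x
  0≤x² x with compare 0# x
  ... | tri< 0<x _ _ = inj₁ (*-pos 0<x 0<x)
  ... | tri≈ _ 0≈x _ = inj₂ (trans (sym (zeroˡ x)) (*-congʳ 0≈x))
  ... | tri> _ _ x<0 = inj₁ (<-respʳ-≈ (solve 1 (λ x → ⊝ x ⊗ ⊝ x , x ⊗ x) (λ _ → refl) (x ∷ []))
                              (*-pos (x<0⇒0<-x x<0) (x<0⇒0<-x x<0)))

  0<1 : 0# < 1#
  0<1 with 0≤x² 1#
  ... | inj₁ 0<1² = <-respʳ-≈ (*-identityˡ 1#) 0<1²
  ... | inj₂ 0≈1² = ⊥-elim (0≉1 (trans 0≈1² (*-identityˡ 1#)))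

  0<2 : 0# < 1# + 1#
  0<2 = <-respˡ-≈ (+-identityˡ 0#) (+-mono-< 0<1 0<1)

  x≉0⇒0<x² : ∀ {x} → ¬ x ≈ 0# → 0# < x * x
  x≉0⇒0<x² {x} x≉0 with 0≤x² x
  ... | inj₁ 0<x² = 0<x²
  ... | inj₂ 0≈x² = ⊥-elim (x≉0 (begin
    x              ≈⟨ *-identityʳ x ⟨
    x * 1#         ≈⟨ *-congˡ xy≈1 ⟨
    x * (x * y)    ≈⟨ *-assoc x x y ⟨
    x * x * y      ≈⟨ *-congʳ 0≈x² ⟨
    0# * y         ≈⟨ zeroˡ y ⟩
    0#             ∎))
    where
    open SetoidReasoning setoid
    y = proj₁ (inverse x≉0)
    xy≈1 = proj₂ (inverse x≉0)

  ⁻¹-inverseʳ : ∀ {x} → ¬ x ≈ 0# → x * x ⁻¹ ≈ 1#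
  ⁻¹-inverseʳ {x} x≉0 with x ≟ 0#
  ... | yes x≈0 = ⊥-elim (x≉0 x≈0)
  ... | no  _   = proj₂ (inverse _)

  -- A zero inverse would give 0 = 1, and a negative one would make the product 1 negative.
  0<x⇒0<x⁻¹ : ∀ {x} → 0# < x → 0# < x ⁻¹
  0<x⇒0<x⁻¹ {x} 0<x with compare 0# (x ⁻¹)
  ... | tri< 0<x⁻¹ _ _ = 0<x⁻¹
  ... | tri≈ _ 0≈x⁻¹ _ = ⊥-elim (0≉1 (trans (sym (zeroʳ x)) (trans (*-congˡ 0≈x⁻¹) (⁻¹-inverseʳ (<⇒≉ 0<x)))))
  ... | tri> _ _ x⁻¹<0 = ⊥-elim (<-irrefl refl (<-trans 0<1 (<-respˡ-≈ lhs (<-respʳ-≈ (zeroˡ x) (*-monoˡ-< 0<x x⁻¹<0)))))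
    where
    lhs : x ⁻¹ * x ≈ 1#
    lhs = trans (*-comm _ _) (⁻¹-inverseʳ (<⇒≉ 0<x))

  ⁻¹-cong : ∀ {x y} → ¬ x ≈ 0# → x ≈ y → x ⁻¹ ≈ y ⁻¹
  ⁻¹-cong {x} {y} x≉0 x≈y = begin
    x ⁻¹                ≈⟨ *-identityʳ _ ⟨
    x ⁻¹ * 1#           ≈⟨ *-congˡ (⁻¹-inverseʳ (λ y≈0 → x≉0 (trans x≈y y≈0))) ⟨
    x ⁻¹ * (y * y ⁻¹)   ≈⟨ *-assoc _ _ _ ⟨
    x ⁻¹ * y * y ⁻¹     ≈⟨ *-congʳ (trans (*-comm _ _) (trans (*-congʳ (sym x≈y)) (⁻¹-inverseʳ x≉0))) ⟩
    1# * y ⁻¹           ≈⟨ *-identityˡ _ ⟩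
    y ⁻¹                ∎
    where open SetoidReasoning setoid

  -- The identity behind AM-GM for q and 1, with `h` as one half: ((1+q)/2)² exceeds q by the square
  -- ((1-q)/2)².
  midpoint² : ∀ q h → (1# + 1#) * h ≈ 1# →
              q + ((1# - q) * h) * ((1# - q) * h) ≈ ((1# + q) * h) * ((1# + q) * h)
  midpoint² q h 2h≈1 = begin
    q + d * d                                           ≈⟨ +-congʳ (*-identityʳ q) ⟨
    q * 1# + d * d                                      ≈⟨ +-congʳ (*-congˡ (trans (*-cong 2h≈1 2h≈1) (*-identityˡ 1#))) ⟨
    q * (((1# + 1#) * h) * ((1# + 1#) * h)) + d * d     ≈⟨ solve 2 (λ q h →
        q ⊗ (((con 1 ⊕ con 1) ⊗ h) ⊗ ((con 1 ⊕ con 1) ⊗ h)) ⊕ ((con 1 ⊝ q) ⊗ h) ⊗ ((con 1 ⊝ q) ⊗ h)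
        , ((con 1 ⊕ q) ⊗ h) ⊗ ((con 1 ⊕ q) ⊗ h)) (λ _ → refl) (q ∷ h ∷ []) ⟩
    ((1# + q) * h) * ((1# + q) * h)                     ∎
    where
    open SetoidReasoning setoid
    d = (1# - q) * h

  record ℝ₊ : Set (c ⊔ ℓ₂) where
    constructor _,_
    field
      value    : Carrier
      positive : 0# < value

  open ℝ₊ public

  -- A record rather than a synonym, so that `x` and `y`, including their positivity proofs, can be
  -- inferred from the type of an equation.
  record _≈₊_ (x y : ℝ₊) : Set ℓ₁ where
    constructor ⟨_⟩
    field ≈-value : value x ≈ value y

  open _≈₊_ public

  record _<₊_ (x y : ℝ₊) : Set ℓ₂ where
    constructor ⟨_⟩
    field <-value : value x < value y

  open _<₊_ public

  ℝ₊-group : AbelianGroup (c ⊔ ℓ₂) ℓ₁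
  ℝ₊-group = record
    { Carrier = ℝ₊
    ; _≈_ = _≈₊_
    ; _∙_ = λ (x , 0<x) (y , 0<y) → x * y , *-pos 0<x 0<y
    ; ε   = 1# , 0<1
    ; _⁻¹ = λ (x , 0<x) → x ⁻¹ , 0<x⇒0<x⁻¹ 0<x
    ; isAbelianGroup = record
      { isGroup = record
        { isMonoid = record
          { isSemigroup = record
            { isMagma = record
              { isEquivalence = isEquivalence₊
              ; ∙-cong = λ p q → ⟨ *-cong (≈-value p) (≈-value q) ⟩
              }
            ; assoc = λ _ _ _ → ⟨ *-assoc _ _ _ ⟩
            }
          ; identity = (λ _ → ⟨ *-identityˡ _ ⟩) , (λ _ → ⟨ *-identityʳ _ ⟩)
          }
        ; inverse = (λ x → ⟨ trans (*-comm _ _) (⁻¹-inverseʳ (<⇒≉ (positive x))) ⟩)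
                  , (λ x → ⟨ ⁻¹-inverseʳ (<⇒≉ (positive x)) ⟩)
        ; ⁻¹-cong = λ {x} p → ⟨ ⁻¹-cong (<⇒≉ (positive x)) (≈-value p) ⟩
        }
      ; comm = λ _ _ → ⟨ *-comm _ _ ⟩
      }
    }
    where
    isEquivalence₊ : IsEquivalence _≈₊_
    isEquivalence₊ = record
      { refl  = ⟨ refl ⟩
      ; sym   = λ p → ⟨ sym (≈-value p) ⟩
      ; trans = λ p q → ⟨ trans (≈-value p) (≈-value q) ⟩
      }

  compare₊ : Trichotomous _≈₊_ _<₊_
  compare₊ x y with compare (value x) (value y)
  ... | tri< a b c = tri< ⟨ a ⟩ (λ p → b (≈-value p)) (λ p → c (<-value p))
  ... | tri≈ a b c = tri≈ (λ p → a (<-value p)) ⟨ b ⟩ (λ p → c (<-value p))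
  ... | tri> a b c = tri> (λ p → a (<-value p)) (λ p → b (≈-value p)) ⟨ c ⟩

  ℝ₊-order : StrictTotalOrder (c ⊔ ℓ₂) ℓ₁ ℓ₂
  ℝ₊-order = record
    { Carrier = ℝ₊
    ; _≈_ = _≈₊_
    ; _<_ = _<₊_
    ; isStrictTotalOrder = record
      { isStrictPartialOrder = record
        { isEquivalence = AbelianGroup.isEquivalence ℝ₊-group
        ; irrefl        = λ p q → <-irrefl (≈-value p) (<-value q)
        ; trans         = λ p q → ⟨ <-trans (<-value p) (<-value q) ⟩
        ; <-resp-≈      = (λ p q → ⟨ <-respʳ-≈ (≈-value p) (<-value q) ⟩)
                        , (λ p q → ⟨ <-respˡ-≈ (≈-value p) (<-value q) ⟩)
        }
      ; compare = compare₊
      }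
    }

-- Existence and uniqueness of n-th roots of positive reals.

module Roots {c ℓ₁ ℓ₂} (ℝ : CompleteOrderedField c ℓ₁ ℓ₂) where

  private module ℝ = CompleteOrderedField ℝ
  private module O = OrderedField ℝ
  open ℝ using (0#; 1#; supremum; UpperBound)
  open O using (ℝ₊; _,_; value; positive; ⟨_⟩; <-value; ≈-value; ℝ₊-group; ℝ₊-order)
  open AbelianGroup ℝ₊-group
  open StrictTotalOrder ℝ₊-order using (_<_; compare; <-respˡ-≈; <-respʳ-≈) renaming (irrefl to <-irrefl; trans to <-trans)
  open StrictTotalOrderProperties ℝ₊-order
  -- The monoid is multiplicative, so `n ×⁺ x` is the n-th power of x.
  open Mult commutativeMonoid using (×-congʳ; ×-distrib-+; ×-idem) renaming (_×_ to _×⁺_)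
  open AbelianGroupSolver ℝ₊-group

  ∙-monoˡ-< : ∀ z {x y} → x < y → x ∙ z < y ∙ z
  ∙-monoˡ-< (_ , 0<z) ⟨ x<y ⟩ = ⟨ O.*-monoˡ-< 0<z x<y ⟩

  ∙-monoʳ-< : ∀ z {x y} → x < y → z ∙ x < z ∙ y
  ∙-monoʳ-< z {x} {y} x<y = <-respˡ-≈ (comm x z) (<-respʳ-≈ (comm y z) (∙-monoˡ-< z x<y))

  ∙-monoˡ-≤ : ∀ z {x y} → x ≤ y → x ∙ z ≤ y ∙ z
  ∙-monoˡ-≤ z (inj₁ x<y) = inj₁ (∙-monoˡ-< z x<y)
  ∙-monoˡ-≤ z (inj₂ x≈y) = inj₂ (∙-congʳ x≈y)

  ∙-monoʳ-≤ : ∀ z {x y} → x ≤ y → z ∙ x ≤ z ∙ y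
  ∙-monoʳ-≤ z (inj₁ x<y) = inj₁ (∙-monoʳ-< z x<y)
  ∙-monoʳ-≤ z (inj₂ x≈y) = inj₂ (∙-congˡ x≈y)

  ∙-mono-≤ : ∀ {x y z w} → x ≤ y → z ≤ w → x ∙ z ≤ y ∙ w
  ∙-mono-≤ {y = y} {z = z} x≤y z≤w = ≤-trans (∙-monoˡ-≤ z x≤y) (∙-monoʳ-≤ y z≤w)

  ×-mono-≤ : ∀ n {x y} → x ≤ y → n ×⁺ x ≤ n ×⁺ y
  ×-mono-≤ zero    x≤y = inj₂ refl
  ×-mono-≤ (suc n) x≤y = ∙-mono-≤ x≤y (×-mono-≤ n x≤y)

  ×-mono-< : ∀ n .{{_ : NonZero n}} {x y} → x < y → n ×⁺ x < n ×⁺ y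
  ×-mono-< (suc n) {y = y} x<y = <-≤-trans (∙-monoˡ-< _ x<y) (∙-monoʳ-≤ y (×-mono-≤ n (inj₁ x<y)))

  ×-injective : ∀ n .{{_ : NonZero n}} {x y} → n ×⁺ x ≈ n ×⁺ y → x ≈ y
  ×-injective n {x} {y} eq with compare x y
  ... | tri< x<y _ _ = ⊥-elim (<-irrefl eq (×-mono-< n x<y))
  ... | tri≈ _ x≈y _ = x≈y
  ... | tri> _ _ x>y = ⊥-elim (<-irrefl (sym eq) (×-mono-< n x>y))

  -- r = (1 + q)/2, by AM-GM.
  root-above : ∀ q → q < ε → ∃[ r ] r < ε × q ≤ r ∙ r
  root-above (q , 0<q) ⟨ q<1 ⟩ = r , ⟨ r<1 ⟩ , q≤r²
    where
    2₊ h : ℝ₊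
    2₊ = 1# ℝ.+ 1# , O.0<2
    h = 2₊ ⁻¹
    2h≈1 : value (2₊ ∙ h) ℝ.≈ 1#
    2h≈1 = ≈-value (inverseʳ 2₊)
    0<1+q : 0# ℝ.< 1# ℝ.+ q
    0<1+q = O.<-respˡ-≈ (ℝ.+-identityˡ 0#) (O.+-mono-< O.0<1 0<q)
    r : ℝ₊
    r = (1# ℝ.+ q , 0<1+q) ∙ h
    r<1 : value r ℝ.< 1#
    r<1 = O.<-respʳ-≈ 2h≈1 (O.*-monoˡ-< (positive h)
      (O.<-respˡ-≈ (ℝ.+-comm _ _) (ℝ.+-monoˡ-< 1# q<1)))
    d : ℝ.Carrier
    d = (1# ℝ.- q) ℝ.* value h
    gap : q ℝ.+ d ℝ.* d ℝ.≈ value (r ∙ r)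
    gap = O.midpoint² q (value h) 2h≈1
    q≤r² : (q , 0<q) ≤ r ∙ r
    q≤r² with O.x≤x+y {q} (O.0≤x² d)
    ... | inj₁ q<q+d² = inj₁ ⟨ O.<-respʳ-≈ gap q<q+d² ⟩
    ... | inj₂ q≈q+d² = inj₂ ⟨ ℝ.trans q≈q+d² gap ⟩

  -- Supplies the room needed to perturb a supremum. Take q ≤ r² with r < 1 and, by induction, r ≤
  -- vⁿ with v < 1; the larger u of r and v satisfies q ≤ r · r ≤ u · uⁿ.
  ×-root-above : ∀ n q → q < ε → ∃[ u ] u < ε × q ≤ n ×⁺ u
  ×-root-above zero    q q<1 = q , q<1 , inj₁ q<1
  ×-root-above (suc n) q q<1 = max (root-above q q<1)
    where
    max : (∃[ r ] r < ε × q ≤ r ∙ r) → ∃[ u ] u < ε × q ≤ suc n ×⁺ u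
    max (r , r<1 , q≤r²) = select (×-root-above n r r<1)
      where
      select : (∃[ v ] v < ε × r ≤ n ×⁺ v) → ∃[ u ] u < ε × q ≤ suc n ×⁺ u
      select (v , v<1 , r≤nv) with compare r v
      ... | tri< r<v _ _ = v , v<1 , ≤-trans q≤r² (∙-mono-≤ (inj₁ r<v) r≤nv)
      ... | tri≈ _ r≈v _ = v , v<1 , ≤-trans q≤r² (∙-mono-≤ (inj₂ r≈v) r≤nv)
      ... | tri> _ _ v<r = r , r<1 , ≤-trans q≤r² (∙-monoʳ-≤ r (≤-trans r≤nv (×-mono-≤ n (inj₁ v<r))))

  ε≤⇒≤× : ∀ n .{{_ : NonZero n}} {x} → ε ≤ x → x ≤ n ×⁺ x
  ε≤⇒≤× (suc zero)        ε≤x = inj₂ (sym (identityʳ _))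
  ε≤⇒≤× (suc n@(suc _))   ε≤x = ≤-trans (inj₂ (sym (identityˡ _))) (∙-mono-≤ ε≤x (ε≤⇒≤× n ε≤x))

  ≤ε⇒×≤ : ∀ n .{{_ : NonZero n}} {x} → x ≤ ε → n ×⁺ x ≤ x
  ≤ε⇒×≤ (suc zero)        x≤ε = inj₂ (identityʳ _)
  ≤ε⇒×≤ (suc n@(suc _))   x≤ε = ≤-trans (∙-mono-≤ x≤ε (≤ε⇒×≤ n x≤ε)) (inj₂ (identityˡ _))

  -- The root is the supremum of all x > 0 with xⁿ ≤ a; trichotomy then leaves two strict
  -- inequalities to refute.
  ∃-root : ∀ n .{{_ : NonZero n}} a → ∃[ s ] n ×⁺ s ≈ a
  ∃-root n a = s , root
    where
    Below : ℝ.Carrier → Set (c ⊔ ℓ₁ ⊔ ℓ₂)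
    Below x = Lift (c ⊔ ℓ₁ ⊔ ℓ₂) (Σ[ 0<x ∈ 0# ℝ.< x ] n ×⁺ (x , 0<x) ≤ a)

    upperBound : ∀ u → (∀ x → n ×⁺ x ≤ a → x ≤ u) → UpperBound Below (value u)
    upperBound u bound x (lift (0<x , xⁿ≤a)) with bound (x , 0<x) xⁿ≤a
    ... | inj₁ ⟨ x<u ⟩ = inj₁ x<u
    ... | inj₂ ⟨ x≈u ⟩ = inj₂ x≈u

    -- The witness is min(1, a): below 1, powers do not exceed their base.
    inhabited : ∃[ x ] n ×⁺ x ≤ a
    inhabited with compare ε a
    ... | tri< 1<a _ _ = ε , ≤-trans (inj₂ (×-idem (identityˡ ε) n)) (inj₁ 1<a)
    ... | tri≈ _ 1≈a _ = ε , inj₂ (trans (×-idem (identityˡ ε) n) 1≈a)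
    ... | tri> _ _ a<1 = a , ≤ε⇒×≤ n (inj₁ a<1)

    -- The bound is max(1, a): any larger x would satisfy a < x ≤ xⁿ.
    bounded : ∃[ u ] ∀ x → n ×⁺ x ≤ a → x ≤ u
    bounded with compare ε a
    ... | tri< 1<a _ _ = a , λ x xⁿ≤a → ≮⇒≥ λ a<x → <⇒≱ a<x (≤-trans (ε≤⇒≤× n (inj₁ (<-trans 1<a a<x))) xⁿ≤a)
    ... | tri≈ _ 1≈a _ = a , λ x xⁿ≤a → ≮⇒≥ λ a<x → <⇒≱ a<x (≤-trans (ε≤⇒≤× n (inj₁ (<-respˡ-≈ (sym 1≈a) a<x))) xⁿ≤a)
    ... | tri> _ _ a<1 = ε , λ x xⁿ≤a → ≮⇒≥ λ 1<x → <⇒≱ (<-trans a<1 1<x) (≤-trans (ε≤⇒≤× n (inj₁ 1<x)) xⁿ≤a)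

    x₀ = proj₁ inhabited
    x₀∈Below : Below (value x₀)
    x₀∈Below = lift (positive x₀ , proj₂ inhabited)
    sup = supremum Below (value x₀ , x₀∈Below) (value (proj₁ bounded) , upperBound (proj₁ bounded) (proj₂ bounded))

    s : ℝ₊
    s = proj₁ sup , O.<-≤-trans (positive x₀) (proj₁ (proj₂ sup) _ x₀∈Below)

    x∙u<x : ∀ {u} x → u < ε → x ∙ u < x
    x∙u<x x u<1 = <-respʳ-≈ (identityʳ x) (∙-monoʳ-< x u<1)

    -- If sⁿ < a then s can be enlarged to s/u, and if a < sⁿ then s can be lowered to su.
    too-small : n ×⁺ s < a → (∃[ u ] u < ε × n ×⁺ s ∙ a ⁻¹ ≤ n ×⁺ u) → ⊥
    too-small sⁿ<a (u , u<1 , q≤uⁿ) = O.<⇒≱ (<-value s<t) (proj₁ (proj₂ sup) (value t) (lift (positive t , tⁿ≤a)))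
      where
      t = s ∙ u ⁻¹
      t∙u≈s : t ∙ u ≈ s
      t∙u≈s = solve 2 (λ s u → s ⊖ u ⊕ u , s) ≡.refl (s ∷ u ∷ [])
      s<t : s < t
      s<t = <-respˡ-≈ t∙u≈s (x∙u<x t u<1)
      tⁿuⁿ≈sⁿ : n ×⁺ t ∙ n ×⁺ u ≈ n ×⁺ s
      tⁿuⁿ≈sⁿ = trans (sym (×-distrib-+ t u n)) (×-congʳ n t∙u≈s)
      tⁿ≤a : n ×⁺ t ≤ a
      tⁿ≤a = ≤-trans (inj₂ (solveFrom 4 (λ tⁿ uⁿ sⁿ a → (tⁿ ⊕ uⁿ , sⁿ) , (tⁿ , (sⁿ ⊖ a) ⊕ (a ⊖ uⁿ)))
                           ≡.refl (n ×⁺ t ∷ n ×⁺ u ∷ n ×⁺ s ∷ a ∷ []) tⁿuⁿ≈sⁿ))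
               (≤-trans (∙-monoˡ-≤ (a ∙ (n ×⁺ u) ⁻¹) q≤uⁿ)
                 (inj₂ (solve 2 (λ uⁿ a → uⁿ ⊕ (a ⊖ uⁿ) , a) ≡.refl (n ×⁺ u ∷ a ∷ []))))

    too-large : a < n ×⁺ s → (∃[ u ] u < ε × a ∙ (n ×⁺ s) ⁻¹ ≤ n ×⁺ u) → ⊥
    too-large a<sⁿ (u , u<1 , q≤uⁿ) = O.<⇒≱ (<-value (x∙u<x s u<1)) (proj₂ (proj₂ sup) (value t) (upperBound t t-bound))
      where
      t = s ∙ u
      a≤tⁿ : a ≤ n ×⁺ t
      a≤tⁿ = ≤-trans (inj₂ (solve 2 (λ a sⁿ → a , sⁿ ⊕ (a ⊖ sⁿ)) ≡.refl (a ∷ n ×⁺ s ∷ [])))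
               (≤-trans (∙-monoʳ-≤ (n ×⁺ s) q≤uⁿ) (inj₂ (sym (×-distrib-+ s u n))))
      t-bound : ∀ x → n ×⁺ x ≤ a → x ≤ t
      t-bound x xⁿ≤a = ≮⇒≥ λ t<x → <⇒≱ (×-mono-< n t<x) (≤-trans xⁿ≤a a≤tⁿ)

    root : n ×⁺ s ≈ a
    root with compare (n ×⁺ s) a
    ... | tri≈ _ eq _ = eq
    -- The ratio of the smaller to the larger of sⁿ and a is below 1, hence at most uⁿ for some u <
    -- 1, and this u is the perturbation.
    ... | tri< sⁿ<a _ _ = ⊥-elim (too-small sⁿ<a
            (×-root-above n _ (<-respʳ-≈ (inverseʳ a) (∙-monoˡ-< (a ⁻¹) sⁿ<a))))
    ... | tri> _ _ a<sⁿ = ⊥-elim (too-large a<sⁿ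
            (×-root-above n _ (<-respʳ-≈ (inverseʳ (n ×⁺ s)) (∙-monoˡ-< ((n ×⁺ s) ⁻¹) a<sⁿ))))

-- Complex numbers, their norm, and square roots on the unit circle.

module ComplexField {c ℓ₁ ℓ₂} (ℝ : CompleteOrderedField c ℓ₁ ℓ₂) where

  open CompleteOrderedField ℝ using (0#; 1#; compare; commutativeRing)
  private module ℝ = CompleteOrderedField ℝ
  private module O = OrderedField ℝ
  private module R = Roots ℝ
  open O using (ℝ₊; _,_; ⟨_⟩; ≈-value; ℝ₊-group)
  private module P = AbelianGroup ℝ₊-group
  open Mult P.commutativeMonoid using () renaming (_×_ to _×⁺_)
  open Complex ℝ
  open RingSolver commutativeRing

  ℂ-isEquivalence : IsEquivalence _≈_
  ℂ-isEquivalence = record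
    { refl  = ℝ.refl , ℝ.refl
    ; sym   = λ (p , q) → ℝ.sym p , ℝ.sym q
    ; trans = λ (p , q) (p′ , q′) → ℝ.trans p p′ , ℝ.trans q q′
    }

  +-cong : ∀ {z z′ w w′} → z ≈ z′ → w ≈ w′ → z + w ≈ z′ + w′
  +-cong (p , q) (p′ , q′) = ℝ.+-cong p p′ , ℝ.+-cong q q′

  *-cong : ∀ {z z′ w w′} → z ≈ z′ → w ≈ w′ → z * w ≈ z′ * w′
  *-cong (p , q) (p′ , q′) =
    ℝ.+-cong (ℝ.*-cong p p′) (ℝ.-‿cong (ℝ.*-cong q q′)) , ℝ.+-cong (ℝ.*-cong p q′) (ℝ.*-cong q p′)

  *-comm : ∀ z w → z * w ≈ w * z
  *-comm (a +i b) (c +i d) =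
      solve 4 (λ a b c d → a ⊗ c ⊝ b ⊗ d , c ⊗ a ⊝ d ⊗ b) (λ _ → ℝ.refl) (a ∷ b ∷ c ∷ d ∷ [])
    , solve 4 (λ a b c d → a ⊗ d ⊕ b ⊗ c , c ⊗ b ⊕ d ⊗ a) (λ _ → ℝ.refl) (a ∷ b ∷ c ∷ d ∷ [])

  *-assoc : ∀ z w v → (z * w) * v ≈ z * (w * v)
  *-assoc (a +i b) (c +i d) (e +i f) =
      solve 6 (λ a b c d e f → (a ⊗ c ⊝ b ⊗ d) ⊗ e ⊝ (a ⊗ d ⊕ b ⊗ c) ⊗ f , a ⊗ (c ⊗ e ⊝ d ⊗ f) ⊝ b ⊗ (c ⊗ f ⊕ d ⊗ e))
        (λ _ → ℝ.refl) (a ∷ b ∷ c ∷ d ∷ e ∷ f ∷ [])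
    , solve 6 (λ a b c d e f → (a ⊗ c ⊝ b ⊗ d) ⊗ f ⊕ (a ⊗ d ⊕ b ⊗ c) ⊗ e , a ⊗ (c ⊗ f ⊕ d ⊗ e) ⊕ b ⊗ (c ⊗ e ⊝ d ⊗ f))
        (λ _ → ℝ.refl) (a ∷ b ∷ c ∷ d ∷ e ∷ f ∷ [])

  *-identityˡ : ∀ z → 1ℂ * z ≈ z
  *-identityˡ (a +i b) =
      solve 2 (λ a b → con 1 ⊗ a ⊝ con 0 ⊗ b , a) (λ _ → ℝ.refl) (a ∷ b ∷ [])
    , solve 2 (λ a b → con 1 ⊗ b ⊕ con 0 ⊗ a , b) (λ _ → ℝ.refl) (a ∷ b ∷ [])

  zeroˡ : ∀ z → 0ℂ * z ≈ 0ℂ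
  zeroˡ (a +i b) =
      solve 2 (λ a b → con 0 ⊗ a ⊝ con 0 ⊗ b , con 0) (λ _ → ℝ.refl) (a ∷ b ∷ [])
    , solve 2 (λ a b → con 0 ⊗ b ⊕ con 0 ⊗ a , con 0) (λ _ → ℝ.refl) (a ∷ b ∷ [])

  distribʳ : ∀ z w v → (w + v) * z ≈ w * z + v * z
  distribʳ (a +i b) (c +i d) (e +i f) =
      solve 6 (λ a b c d e f → (c ⊕ e) ⊗ a ⊝ (d ⊕ f) ⊗ b , (c ⊗ a ⊝ d ⊗ b) ⊕ (e ⊗ a ⊝ f ⊗ b))
        (λ _ → ℝ.refl) (a ∷ b ∷ c ∷ d ∷ e ∷ f ∷ [])
    , solve 6 (λ a b c d e f → (c ⊕ e) ⊗ b ⊕ (d ⊕ f) ⊗ a , (c ⊗ b ⊕ d ⊗ a) ⊕ (e ⊗ b ⊕ f ⊗ a))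
        (λ _ → ℝ.refl) (a ∷ b ∷ c ∷ d ∷ e ∷ f ∷ [])

  ℂ-semiring : CommutativeSemiring c ℓ₁
  ℂ-semiring = record
    { Carrier = ℂ
    ; _≈_ = _≈_
    ; _+_ = _+_
    ; _*_ = _*_
    ; 0#  = 0ℂ
    ; 1#  = 1ℂ
    ; isCommutativeSemiring = record
      { isSemiring = record
        { isSemiringWithoutAnnihilatingZero = record
          { +-isCommutativeMonoid = record
            { isMonoid = record
              { isSemigroup = record
                { isMagma = record { isEquivalence = ℂ-isEquivalence ; ∙-cong = +-cong }
                ; assoc = λ _ _ _ → ℝ.+-assoc _ _ _ , ℝ.+-assoc _ _ _
                }
              ; identity = (λ _ → ℝ.+-identityˡ _ , ℝ.+-identityˡ _) , (λ _ → ℝ.+-identityʳ _ , ℝ.+-identityʳ _)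
              }
            ; comm = λ _ _ → ℝ.+-comm _ _ , ℝ.+-comm _ _
            }
          ; *-cong     = *-cong
          ; *-assoc    = *-assoc
          ; *-identity = *-identityˡ , λ z → ≈-trans (*-comm z 1ℂ) (*-identityˡ z)
          ; distrib    = (λ z w v → ≈-trans (*-comm z (w + v)) (≈-trans (distribʳ z w v) (+-cong (*-comm w z) (*-comm v z))))
                       , distribʳ
          }
        ; zero = zeroˡ , λ z → ≈-trans (*-comm z 0ℂ) (zeroˡ z)
        }
      ; *-comm = *-comm
      }
    }
    where
    open IsEquivalence ℂ-isEquivalence renaming (trans to ≈-trans)

  open CommutativeSemiring ℂ-semiring public using (*-congˡ; *-congʳ; *-identityʳ; zeroʳ) renaming (refl to ≈-refl; sym to ≈-sym; trans to ≈-trans; setoid to ℂ-setoid)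

  normSq-cong : ∀ {z w} → z ≈ w → normSq z ℝ.≈ normSq w
  normSq-cong (p , q) = ℝ.+-cong (ℝ.*-cong p p) (ℝ.*-cong q q)

  normSq-* : ∀ z w → normSq (z * w) ℝ.≈ normSq z ℝ.* normSq w
  normSq-* (a +i b) (c +i d) =
    solve 4 (λ a b c d → (a ⊗ c ⊝ b ⊗ d) ⊗ (a ⊗ c ⊝ b ⊗ d) ⊕ (a ⊗ d ⊕ b ⊗ c) ⊗ (a ⊗ d ⊕ b ⊗ c)
      , (a ⊗ a ⊕ b ⊗ b) ⊗ (c ⊗ c ⊕ d ⊗ d)) (λ _ → ℝ.refl) (a ∷ b ∷ c ∷ d ∷ [])

  normSq-positive : ∀ {z} → z ≉ 0ℂ → 0# ℝ.< normSq z
  normSq-positive {a +i b} z≉0 with a ℝ.≟ 0# | b ℝ.≟ 0#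
  ... | yes a≈0 | yes b≈0 = ⊥-elim (z≉0 (a≈0 , b≈0))
  ... | no  a≉0 | _       = O.<-≤-trans (O.x≉0⇒0<x² a≉0) (O.x≤x+y (O.0≤x² b))
  ... | yes _   | no  b≉0 = O.<-respʳ-≈ (ℝ.+-comm _ _) (O.<-≤-trans (O.x≉0⇒0<x² b≉0) (O.x≤x+y (O.0≤x² a)))

  normSq-0 : normSq 0ℂ ℝ.≈ 0#
  normSq-0 = solve 0 (con 0 ⊗ con 0 ⊕ con 0 ⊗ con 0 , con 0) (λ _ → ℝ.refl) []

  normSq>0⇒≉0 : ∀ {z} → 0# ℝ.< normSq z → z ≉ 0ℂ
  normSq>0⇒≉0 0<n z≈0 = O.<⇒≉ 0<n (ℝ.trans (normSq-cong z≈0) normSq-0)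

  *-nonzero : ∀ {z w} → z ≉ 0ℂ → w ≉ 0ℂ → z * w ≉ 0ℂ
  *-nonzero z≉0 w≉0 = normSq>0⇒≉0 (O.<-respʳ-≈ (ℝ.sym (normSq-* _ _)) (ℝ.*-pos (normSq-positive z≉0) (normSq-positive w≉0)))

  1≉0 : 1ℂ ≉ 0ℂ
  1≉0 (1≈0 , _) = ℝ.0≉1 (ℝ.sym 1≈0)

  *-inverseʳ : ∀ {z} → z ≉ 0ℂ → z * z ⁻¹ ≈ 1ℂ
  *-inverseʳ {z@(a +i b)} z≉0 =
      ℝ.trans (solve 3 (λ a b n → a ⊗ (a ⊗ n) ⊝ b ⊗ (⊝ b ⊗ n) , (a ⊗ a ⊕ b ⊗ b) ⊗ n) (λ _ → ℝ.refl) (a ∷ b ∷ normSq z ℝ.⁻¹ ∷ []))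
        (O.⁻¹-inverseʳ (O.<⇒≉ (normSq-positive z≉0)))
    , solve 3 (λ a b n → a ⊗ (⊝ b ⊗ n) ⊕ b ⊗ (a ⊗ n) , con 0) (λ _ → ℝ.refl) (a ∷ b ∷ normSq z ℝ.⁻¹ ∷ [])

  ⁻¹-nonzero : ∀ {z} → z ≉ 0ℂ → z ⁻¹ ≉ 0ℂ
  ⁻¹-nonzero z≉0 z⁻¹≈0 = 1≉0 (≈-trans (≈-sym (*-inverseʳ z≉0)) (≈-trans (*-congˡ z⁻¹≈0) (zeroʳ _)))

  ⁻¹-cong : ∀ {z w} → z ≉ 0ℂ → z ≈ w → z ⁻¹ ≈ w ⁻¹
  ⁻¹-cong z≉0 z≈w@(p , q) = ℝ.*-cong p n⁻¹ , ℝ.*-cong (ℝ.-‿cong q) n⁻¹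
    where n⁻¹ = O.⁻¹-cong (O.<⇒≉ (normSq-positive z≉0)) (normSq-cong z≈w)

  conj-* : ∀ z → z * conj z ≈ (normSq z +i 0#)
  conj-* (a +i b) =
      solve 2 (λ a b → a ⊗ a ⊝ b ⊗ ⊝ b , a ⊗ a ⊕ b ⊗ b) (λ _ → ℝ.refl) (a ∷ b ∷ [])
    , solve 2 (λ a b → a ⊗ ⊝ b ⊕ b ⊗ a , con 0) (λ _ → ℝ.refl) (a ∷ b ∷ [])

  infix 4 _≈ˣ_

  record ℂˣ : Set (c ⊔ ℓ₁) where
    constructor _,_
    field
      number  : ℂ
      nonzero : number ≉ 0ℂ

  open ℂˣ public

  record _≈ˣ_ (z w : ℂˣ) : Set ℓ₁ where
    constructor ⟨_⟩
    field ≈-number : number z ≈ number w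

  open _≈ˣ_ public

  ℂˣ-group : AbelianGroup (c ⊔ ℓ₁) ℓ₁
  ℂˣ-group = record
    { Carrier = ℂˣ
    ; _≈_ = _≈ˣ_
    ; _∙_ = λ (z , z≉0) (w , w≉0) → z * w , *-nonzero z≉0 w≉0
    ; ε   = 1ℂ , 1≉0
    ; _⁻¹ = λ (z , z≉0) → z ⁻¹ , ⁻¹-nonzero z≉0
    ; isAbelianGroup = record
      { isGroup = record
        { isMonoid = record
          { isSemigroup = record
            { isMagma = record
              { isEquivalence = record
                { refl  = ⟨ ≈-refl ⟩
                ; sym   = λ p → ⟨ ≈-sym (≈-number p) ⟩
                ; trans = λ p q → ⟨ ≈-trans (≈-number p) (≈-number q) ⟩
                }
              ; ∙-cong = λ p q → ⟨ *-cong (≈-number p) (≈-number q) ⟩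
              }
            ; assoc = λ _ _ _ → ⟨ *-assoc _ _ _ ⟩
            }
          ; identity = (λ _ → ⟨ *-identityˡ _ ⟩) , (λ _ → ⟨ *-identityʳ _ ⟩)
          }
        ; inverse = (λ z → ⟨ ≈-trans (*-comm _ _) (*-inverseʳ (nonzero z)) ⟩) , (λ z → ⟨ *-inverseʳ (nonzero z) ⟩)
        ; ⁻¹-cong = λ {z} p → ⟨ ⁻¹-cong (nonzero z) (≈-number p) ⟩
        }
      ; comm = λ _ _ → ⟨ *-comm _ _ ⟩
      }
    }

  private module X = AbelianGroup ℂˣ-group

  -- The square of the modulus: it needs no real root, is still multiplicative, and has the same
  -- kernel, the unit circle.
  norm : ℂˣ → ℝ₊
  norm (z , z≉0) = normSq z , normSq-positive z≉0

  norm-cong : ∀ {z w} → z ≈ˣ w → norm z P.≈ norm w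
  norm-cong ⟨ p ⟩ = ⟨ normSq-cong p ⟩

  norm-∙ : ∀ z w → norm (z X.∙ w) P.≈ norm z P.∙ norm w
  norm-∙ z w = ⟨ normSq-* (number z) (number w) ⟩

  modulus₁⇒norm : ∀ z → HasModulus (number z) 1# → norm z P.≈ P.ε
  modulus₁⇒norm z (_ , 1²≈n) = ⟨ ℝ.trans (ℝ.sym 1²≈n) (ℝ.*-identityˡ 1#) ⟩

  norm⇒modulus₁ : ∀ z → norm z P.≈ P.ε → HasModulus (number z) 1#
  norm⇒modulus₁ z ⟨ n≈1 ⟩ = inj₁ O.0<1 , ℝ.trans (ℝ.*-identityˡ 1#) (ℝ.sym n≈1)

  ∃-norm : ∀ p → ∃[ z ] norm z P.≈ p
  ∃-norm p = z , P.trans ⟨ normSq-real ⟩ (proj₂ (R.∃-root 2 p))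
    where
    s = proj₁ (R.∃-root 2 p)
    normSq-real : normSq (O.value s +i 0#) ℝ.≈ O.value (2 ×⁺ s)
    normSq-real = solve 1 (λ s → s ⊗ s ⊕ con 0 ⊗ con 0 , s ⊗ (s ⊗ con 1)) (λ _ → ℝ.refl) (O.value s ∷ [])
    z : ℂˣ
    z = (O.value s +i 0#) , λ (s≈0 , _) → O.<⇒≉ (O.positive s) s≈0

  -- For |z| = 1 and z ≠ -1 this is (1 + z)/|1 + z|, where |1 + z|² = 2(1 + Re z).
  private
    twice : ∀ {x} → 0# ℝ.< x → ℝ₊
    twice {x} 0<x = x ℝ.+ x , O.<-respˡ-≈ (ℝ.+-identityˡ 0#) (O.+-mono-< 0<x 0<x)

    -- At x = 1 + Re z with |z| = 1 this is 1/|1 + z|.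
    scale : ∀ {x} → 0# ℝ.< x → ℝ₊
    scale 0<x = proj₁ (R.∃-root 2 (twice 0<x)) P.⁻¹

    scale² : ∀ {x} (0<x : 0# ℝ.< x) → O.value (scale 0<x) ℝ.* O.value (scale 0<x) ℝ.* (x ℝ.+ x) ℝ.≈ 1#
    scale² 0<x = ≈-value (AbelianGroupSolver.solveFrom ℝ₊-group 2
      (λ r a → (a , r S.⊕ (r S.⊕ S.one)) , (S.inv r S.⊕ S.inv r S.⊕ a , S.one))
      ≡.refl (proj₁ root ∷ twice 0<x ∷ []) (P.sym (proj₂ root)))
      where
      module S = AbelianGroupSolver ℝ₊-group
      root = R.∃-root 2 (twice 0<x)

    scale-cong : ∀ {x y} (0<x : 0# ℝ.< x) (0<y : 0# ℝ.< y) → x ℝ.≈ y → scale 0<x P.≈ scale 0<y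
    scale-cong 0<x 0<y x≈y = P.⁻¹-cong (R.×-injective 2 (P.trans (proj₂ (R.∃-root 2 (twice 0<x)))
      (P.trans ⟨ ℝ.+-cong x≈y x≈y ⟩ (P.sym (proj₂ (R.∃-root 2 (twice 0<y)))))))

    -- The comparison is an argument so that congruence can be proved for two unrelated outcomes of
    -- `compare`. On the unit circle the middle case is z = -1, with root i; the last case does not
    -- occur there and repeats i as a default.
    rootOf : ∀ z → Tri (0# ℝ.< 1# ℝ.+ re z) (0# ℝ.≈ 1# ℝ.+ re z) (1# ℝ.+ re z ℝ.< 0#) → ℂˣ
    rootOf z (tri< 0<1+x _ _) =
      (((1# ℝ.+ re z) ℝ.* O.value (scale 0<1+x)) +i (im z ℝ.* O.value (scale 0<1+x)))
      , λ (eq , _) → O.<⇒≉ (ℝ.*-pos 0<1+x (O.positive (scale 0<1+x))) eq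
    rootOf z (tri≈ _ _ _) = (0# +i 1#) , λ (_ , 1≈0) → ℝ.0≉1 (ℝ.sym 1≈0)
    rootOf z (tri> _ _ _) = (0# +i 1#) , λ (_ , 1≈0) → ℝ.0≉1 (ℝ.sym 1≈0)

    rootOf-cong : ∀ {z w} t t′ → z ≈ w → rootOf z t ≈ˣ rootOf w t′
    rootOf-cong (tri< a _ _) (tri< b _ _) (p , q) = ⟨ ℝ.*-cong (ℝ.+-congˡ p) s , ℝ.*-cong q s ⟩
      where s = ≈-value (scale-cong a b (ℝ.+-congˡ p))
    rootOf-cong (tri< a _ _) (tri≈ b _ _) (p , _) = ⊥-elim (b (O.<-respʳ-≈ (ℝ.+-congˡ p) a))
    rootOf-cong (tri< a _ _) (tri> b _ _) (p , _) = ⊥-elim (b (O.<-respʳ-≈ (ℝ.+-congˡ p) a))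
    rootOf-cong (tri≈ a _ _) (tri< b _ _) (p , _) = ⊥-elim (a (O.<-respʳ-≈ (ℝ.+-congˡ (ℝ.sym p)) b))
    rootOf-cong (tri> a _ _) (tri< b _ _) (p , _) = ⊥-elim (a (O.<-respʳ-≈ (ℝ.+-congˡ (ℝ.sym p)) b))
    rootOf-cong (tri≈ _ _ _) (tri≈ _ _ _) _ = X.refl
    rootOf-cong (tri≈ _ _ _) (tri> _ _ _) _ = X.refl
    rootOf-cong (tri> _ _ _) (tri≈ _ _ _) _ = X.refl
    rootOf-cong (tri> _ _ _) (tri> _ _ _) _ = X.refl

    -- On the unit circle this rules out Re z < -1, since a norm is not negative, and forces Im z =
    -- 0 when Re z = -1.
    chord : ∀ {z} → normSq z ℝ.≈ 1# → (1# ℝ.+ re z) ℝ.+ (1# ℝ.+ re z) ℝ.≈ normSq (1ℂ + z)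
    chord {a +i b} n≈1 = begin
      (1# ℝ.+ a) ℝ.+ (1# ℝ.+ a)                         ≈⟨ solve 1 (λ a → (con 1 ⊕ a) ⊕ (con 1 ⊕ a) , (con 1 ⊕ a ⊕ a) ⊕ con 1) (λ _ → ℝ.refl) (a ∷ []) ⟩
      (1# ℝ.+ a ℝ.+ a) ℝ.+ 1#                           ≈⟨ ℝ.+-congˡ n≈1 ⟨
      (1# ℝ.+ a ℝ.+ a) ℝ.+ (a ℝ.* a ℝ.+ b ℝ.* b)        ≈⟨ solve 2 (λ a b → (con 1 ⊕ a ⊕ a) ⊕ (a ⊗ a ⊕ b ⊗ b)
                                                             , (con 1 ⊕ a) ⊗ (con 1 ⊕ a) ⊕ (con 0 ⊕ b) ⊗ (con 0 ⊕ b)) (λ _ → ℝ.refl) (a ∷ b ∷ []) ⟩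
      normSq (1ℂ + (a +i b))                            ∎
      where open SetoidReasoning ℝ.setoid

    rootOf-square : ∀ z t → normSq (number z) ℝ.≈ 1# → rootOf (number z) t X.∙ rootOf (number z) t ≈ˣ z
    rootOf-square ((x +i y) , _) (tri< 0<1+x _ _) n≈1 = ⟨ real , imaginary ⟩
      where
      open SetoidReasoning ℝ.setoid
      s = O.value (scale 0<1+x)
      real : ((1# ℝ.+ x) ℝ.* s) ℝ.* ((1# ℝ.+ x) ℝ.* s) ℝ.- (y ℝ.* s) ℝ.* (y ℝ.* s) ℝ.≈ x
      -- Adding s², written as s²(x² + y²), eliminates y and leaves x · 2s²(1 + x) plus s², where
      -- 2s²(1 + x) = 1.
      real = AbelianGroupProperties.∙-cancelʳ ℝ.+-abelianGroup (s ℝ.* s ℝ.* 1#) _ _ (begin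
        (((1# ℝ.+ x) ℝ.* s) ℝ.* ((1# ℝ.+ x) ℝ.* s) ℝ.- (y ℝ.* s) ℝ.* (y ℝ.* s)) ℝ.+ s ℝ.* s ℝ.* 1#
          ≈⟨ ℝ.+-congˡ (ℝ.*-congˡ n≈1) ⟨
        (((1# ℝ.+ x) ℝ.* s) ℝ.* ((1# ℝ.+ x) ℝ.* s) ℝ.- (y ℝ.* s) ℝ.* (y ℝ.* s)) ℝ.+ s ℝ.* s ℝ.* (x ℝ.* x ℝ.+ y ℝ.* y)
          ≈⟨ solve 3 (λ x y s → (((con 1 ⊕ x) ⊗ s) ⊗ ((con 1 ⊕ x) ⊗ s) ⊝ (y ⊗ s) ⊗ (y ⊗ s)) ⊕ s ⊗ s ⊗ (x ⊗ x ⊕ y ⊗ y)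
              , x ⊗ (s ⊗ s ⊗ ((con 1 ⊕ x) ⊕ (con 1 ⊕ x))) ⊕ s ⊗ s ⊗ con 1) (λ _ → ℝ.refl) (x ∷ y ∷ s ∷ []) ⟩
        x ℝ.* (s ℝ.* s ℝ.* ((1# ℝ.+ x) ℝ.+ (1# ℝ.+ x))) ℝ.+ s ℝ.* s ℝ.* 1#
          ≈⟨ ℝ.+-congʳ (ℝ.trans (ℝ.*-congˡ (scale² 0<1+x)) (ℝ.*-identityʳ x)) ⟩
        x ℝ.+ s ℝ.* s ℝ.* 1# ∎)
      imaginary : ((1# ℝ.+ x) ℝ.* s) ℝ.* (y ℝ.* s) ℝ.+ (y ℝ.* s) ℝ.* ((1# ℝ.+ x) ℝ.* s) ℝ.≈ y
      imaginary = ℝ.trans (solve 3 (λ x y s → ((con 1 ⊕ x) ⊗ s) ⊗ (y ⊗ s) ⊕ (y ⊗ s) ⊗ ((con 1 ⊕ x) ⊗ s)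
          , y ⊗ (s ⊗ s ⊗ ((con 1 ⊕ x) ⊕ (con 1 ⊕ x)))) (λ _ → ℝ.refl) (x ∷ y ∷ s ∷ []))
        (ℝ.trans (ℝ.*-congˡ (scale² 0<1+x)) (ℝ.*-identityʳ y))
    rootOf-square (z@(x +i y) , _) (tri≈ _ 0≈1+x _) n≈1 = ⟨ real , imaginary ⟩
      where
      open SetoidReasoning ℝ.setoid
      real : 0# ℝ.* 0# ℝ.- 1# ℝ.* 1# ℝ.≈ x
      real = begin
        0# ℝ.* 0# ℝ.- 1# ℝ.* 1#     ≈⟨ solve 0 (con 0 ⊗ con 0 ⊝ con 1 ⊗ con 1 , con 0 ⊝ con 1) (λ _ → ℝ.refl) [] ⟩
        0# ℝ.- 1#                   ≈⟨ ℝ.+-congʳ 0≈1+x ⟩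
        (1# ℝ.+ x) ℝ.- 1#           ≈⟨ solve 1 (λ x → (con 1 ⊕ x) ⊝ con 1 , x) (λ _ → ℝ.refl) (x ∷ []) ⟩
        x                           ∎
      chord≈0 : normSq (1ℂ + z) ℝ.≈ 0#
      chord≈0 = ℝ.trans (ℝ.sym (chord n≈1)) (ℝ.trans (ℝ.+-cong (ℝ.sym 0≈1+x) (ℝ.sym 0≈1+x)) (ℝ.+-identityˡ 0#))
      y≈0 : y ℝ.≈ 0#
      y≈0 with y ℝ.≟ 0#
      ... | yes y≈0 = y≈0
      ... | no  y≉0 = ⊥-elim (O.<⇒≉ (normSq-positive (λ (_ , 0+y≈0) → y≉0 (ℝ.trans (ℝ.sym (ℝ.+-identityˡ y)) 0+y≈0))) chord≈0)
      imaginary : 0# ℝ.* 1# ℝ.+ 1# ℝ.* 0# ℝ.≈ y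
      imaginary = ℝ.trans (solve 0 (con 0 ⊗ con 1 ⊕ con 1 ⊗ con 0 , con 0) (λ _ → ℝ.refl) []) (ℝ.sym y≈0)
    rootOf-square (z@(x +i y) , _) (tri> _ 1+x≉0 1+x<0) n≈1 =
      ⊥-elim (O.<⇒≱ (O.<-respˡ-≈ (chord n≈1) (O.<-respʳ-≈ (ℝ.+-identityˡ 0#) (O.+-mono-< 1+x<0 1+x<0)))
        (inj₁ (normSq-positive λ (1+x≈0 , _) → 1+x≉0 (ℝ.sym 1+x≈0))))

  √ : ℂˣ → ℂˣ
  √ z = rootOf (number z) (compare 0# (1# ℝ.+ re (number z)))

  √-cong : ∀ {z w} → z ≈ˣ w → √ z ≈ˣ √ w
  √-cong {z} {w} ⟨ p ⟩ = rootOf-cong (compare 0# (1# ℝ.+ re (number z))) (compare 0# (1# ℝ.+ re (number w))) p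

  √-square : ∀ z → norm z P.≈ P.ε → √ z X.∙ √ z ≈ˣ z
  √-square z ⟨ n≈1 ⟩ = rootOf-square z (compare 0# (1# ℝ.+ re (number z))) n≈1

  -- Fixes the sign of the branch, on which the diagonal of an H-weight depends. The root of 1 is 2s
  -- with s > 0 and (2s)² = 1, and positive square roots are unique.
  √-ε : √ X.ε ≈ˣ X.ε
  √-ε = rootOf-ε (compare 0# (1# ℝ.+ 1#))
    where
    rootOf-ε : ∀ t → rootOf 1ℂ t ≈ˣ X.ε
    rootOf-ε (tri< 0<2 _ _) = ⟨ ≈-value 2s≈1 , ℝ.zeroˡ _ ⟩
      where
      2₊ : ℝ₊
      2₊ = 1# ℝ.+ 1# , 0<2
      2s≈1 : 2₊ P.∙ scale 0<2 P.≈ P.ε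
      2s≈1 = R.×-injective 2 ⟨ ℝ.trans
        (solve 1 (λ s → ((con 1 ⊕ con 1) ⊗ s) ⊗ (((con 1 ⊕ con 1) ⊗ s) ⊗ con 1)
          , s ⊗ s ⊗ ((con 1 ⊕ con 1) ⊕ (con 1 ⊕ con 1))) (λ _ → ℝ.refl) (O.value (scale 0<2) ∷ []))
        (ℝ.trans (scale² 0<2) (solve 0 (con 1 , con 1 ⊗ (con 1 ⊗ con 1)) (λ _ → ℝ.refl) [])) ⟩
    rootOf-ε (tri≈ 0≮2 _ _) = ⊥-elim (0≮2 O.0<2)
    rootOf-ε (tri> 0≮2 _ _) = ⊥-elim (0≮2 O.0<2)

-- Translations of a group and sums over a finite group.

module GroupTranslations {g ℓg} (𝔾 : Group g ℓg) where

  open Group 𝔾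
  open GroupProperties 𝔾 public using (\\-leftDividesˡ; \\-leftDividesʳ; \\-cong₂; ⁻¹-anti-homo-∙; ε⁻¹≈ε; ⁻¹-involutive)
  open SetoidReasoning setoid

  x∙h≈y⇒x\\y≈h : ∀ {x h y} → x ∙ h ≈ y → x \\ y ≈ h
  x∙h≈y⇒x\\y≈h {x} {h} xh≈y = trans (∙-congˡ (sym xh≈y)) (\\-leftDividesʳ x h)

  x\\y≈h⇒x∙h≈y : ∀ {x h y} → x \\ y ≈ h → x ∙ h ≈ y
  x\\y≈h⇒x∙h≈y {x} {h} {y} x\\y≈h = trans (∙-congˡ (sym x\\y≈h)) (\\-leftDividesˡ x y)

  translated-\\ : ∀ t x y → (t ∙ x) \\ (t ∙ y) ≈ x \\ y
  translated-\\ t x y = begin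
    (t ∙ x) ⁻¹ ∙ (t ∙ y)        ≈⟨ ∙-congʳ (⁻¹-anti-homo-∙ t x) ⟩
    x ⁻¹ ∙ t ⁻¹ ∙ (t ∙ y)       ≈⟨ assoc _ _ _ ⟩
    x ⁻¹ ∙ (t ⁻¹ ∙ (t ∙ y))     ≈⟨ ∙-congˡ (\\-leftDividesʳ t y) ⟩
    x ⁻¹ ∙ y                    ∎

  ∙-\\ : ∀ x z y → (x ∙ z) \\ y ≈ z \\ (x \\ y)
  ∙-\\ x z y = trans (∙-congʳ (⁻¹-anti-homo-∙ x z)) (assoc _ _ _)

  \\-⁻¹ : ∀ x y → (x \\ y) ⁻¹ ≈ y \\ x
  \\-⁻¹ x y = trans (⁻¹-anti-homo-∙ (x ⁻¹) y) (∙-congˡ (⁻¹-involutive x))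

  leftTranslation rightTranslation : Carrier → Inverse setoid setoid
  leftTranslation t = record
    { to        = t ∙_
    ; from      = t \\_
    ; to-cong   = ∙-congˡ
    ; from-cong = ∙-congˡ
    ; inverse   = (λ {x} y≈t\\x → trans (∙-congˡ y≈t\\x) (\\-leftDividesˡ t x))
                , (λ {x} y≈tx → trans (∙-congˡ y≈tx) (\\-leftDividesʳ t x))
    }
  rightTranslation t = record
    { to        = _∙ t
    ; from      = _∙ t ⁻¹
    ; to-cong   = ∙-congʳ
    ; from-cong = ∙-congʳ
    ; inverse   = (λ {x} p → trans (∙-congʳ p) (trans (assoc _ _ _) (trans (∙-congˡ (inverseˡ t)) (identityʳ x))))
                , (λ {x} p → trans (∙-congʳ p) (trans (assoc _ _ _) (trans (∙-congˡ (inverseʳ t)) (identityʳ x))))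
    }

module FiniteGroupProperties {g ℓg} (𝔾 : FiniteGroup g ℓg) where

  open FiniteGroup 𝔾
  open GroupTranslations group public
  private module E = Inverse enumeration

  order-nonZero : NonZero order
  order-nonZero = inhabited (E.to ε)
    where
    inhabited : ∀ {n} → Fin n → NonZero n
    inhabited {suc n} _ = _

  -- Choosing for the canonical representative elementAt (to x) makes the choice respect ≈.
  choose : ∀ {a ℓ p} {A : Set a} {_∼_ : A → A → Set ℓ} (∼-reflexive : ∀ {u v} → u ≡ v → u ∼ v)
           (R : Carrier → A → Set p) → (∀ {x y u} → x ≈ y → R x u → R y u) → (∀ x → ∃ (R x)) →
           Σ[ f ∈ (Carrier → A) ] (∀ {x y} → x ≈ y → f x ∼ f y) × (∀ x → R x (f x))
  choose ∼-reflexive R R-resp total =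
      (λ x → proj₁ (total (elementAt (E.to x))))
    , (λ x≈y → ∼-reflexive (≡.cong (λ i → proj₁ (total (elementAt i))) (E.to-cong x≈y)))
    , (λ x → R-resp (E.strictlyInverseʳ x) (proj₂ (total (elementAt (E.to x)))))

module GroupSum {c ℓ g ℓg} (M : CommutativeMonoid c ℓ) (𝔾 : FiniteGroup g ℓg) where

  open CommutativeMonoid M
  private module G = FiniteGroup 𝔾
  private module E = Inverse G.enumeration
  open Sum M using (sum; sum-remove; sum-cong-≋; sum-permute; ∑-distrib-+; sum-replicate; sum-replicate-zero)
  open Mult M using () renaming (_×_ to _×⁺_)

  -- Instantiated with addition in ℂ for matrix products and with multiplication in ℝ₊ for products
  -- over G.
  ∑ : (G.Carrier → Carrier) → Carrier
  ∑ f = sum (λ i → f (G.elementAt i))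

  ∑-cong : ∀ {f h} → (∀ x → f x ≈ h x) → ∑ f ≈ ∑ h
  ∑-cong f≈h = sum-cong-≋ (λ i → f≈h (G.elementAt i))

  ∑-distrib : ∀ f h → ∑ (λ x → f x ∙ h x) ≈ ∑ f ∙ ∑ h
  ∑-distrib f h = ∑-distrib-+ (λ i → f (G.elementAt i)) (λ i → h (G.elementAt i))

  ∑-const : ∀ u → ∑ (λ _ → u) ≈ G.order ×⁺ u
  ∑-const u = sum-replicate G.order

  ∑-reindex : ∀ (σ : Inverse G.setoid G.setoid) {f} → f Preserves G._≈_ ⟶ _≈_ → ∑ f ≈ ∑ (λ x → f (Inverse.to σ x))
  ∑-reindex σ {f} f-cong = trans (sum-permute (λ i → f (G.elementAt i)) π)
    (sum-cong-≋ (λ i → f-cong (E.strictlyInverseʳ (S.to (G.elementAt i)))))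
    where
    module S = Inverse σ
    π : Inverse (≡.setoid (Fin G.order)) (≡.setoid (Fin G.order))
    π = record
      { to        = λ i → E.to (S.to (E.from i))
      ; from      = λ i → E.to (S.from (E.from i))
      ; to-cong   = ≡.cong _
      ; from-cong = ≡.cong _
      ; inverse   = (λ { {i} ≡.refl → ≡.trans (E.to-cong (S.inverseˡ (E.strictlyInverseʳ _))) (E.strictlyInverseˡ i) })
                  , (λ { {i} ≡.refl → ≡.trans (E.to-cong (S.inverseʳ (E.strictlyInverseʳ _))) (E.strictlyInverseˡ i) })
      }

  sum-single : ∀ {n} (f : Fin n → Carrier) i → (∀ j → j ≢ i → f j ≈ ε) → sum f ≈ f i
  sum-single {suc n} f i f≈ε = trans (sum-remove f) (trans (∙-congˡ
    (trans (sum-cong-≋ (λ j → f≈ε (punchIn i j) (punchInᵢ≢i i j))) (sum-replicate-zero n))) (identityʳ (f i)))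

  -- The sum visits only the enumerated representative of x, which is equal to x merely in the
  -- setoid; hence the hypothesis on every z equal to x.
  ∑-single : ∀ x {f u} → (∀ z → x G.≈ z → f z ≈ u) → (∀ z → ¬ x G.≈ z → f z ≈ ε) → ∑ f ≈ u
  ∑-single x {f} f≈u f≈ε = trans
    (sum-single (λ i → f (G.elementAt i)) (E.to x)
      (λ j j≢ → f≈ε _ (λ x≈ → j≢ (≡.trans (≡.sym (E.strictlyInverseˡ j)) (≡.sym (E.to-cong x≈))))))
    (f≈u _ (G.sym (E.strictlyInverseʳ x)))

-- Entries of span elements and of transformed matrices.

module Entries {r ℓr₁ ℓr₂ g ℓg} (ℝ : CompleteOrderedField r ℓr₁ ℓr₂) (𝔾 : FiniteGroup g ℓg) where

  private module G = FiniteGroup 𝔾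
  open FiniteGroupProperties 𝔾
  open Complex ℝ
  open ComplexField ℝ
  open ThinConfiguration ℝ 𝔾 hiding (c; _^_)
  open GroupSum (CommutativeSemiring.+-commutativeMonoid ℂ-semiring) 𝔾 public
  open SetoidReasoning ℂ-setoid

  indicator-true : ∀ {p} {Q : Set p} (Q? : Dec Q) → Q → indicator Q? ≈ 1ℂ
  indicator-true (yes _) _ = ≈-refl
  indicator-true (no ¬q) q = ⊥-elim (¬q q)

  indicator-false : ∀ {p} {Q : Set p} (Q? : Dec Q) → ¬ Q → indicator Q? ≈ 0ℂ
  indicator-false (yes q) ¬q = ⊥-elim (¬q q)
  indicator-false (no _)  _  = ≈-refl

  indicator-cong : ∀ {p q} {Q : Set p} {R : Set q} (Q? : Dec Q) (R? : Dec R) → (Q → R) → (R → Q) →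
                   indicator Q? ≈ indicator R?
  indicator-cong (yes q) R? f _ = ≈-sym (indicator-true R? (f q))
  indicator-cong (no ¬q) R? _ h = ≈-sym (indicator-false R? (λ r → ¬q (h r)))

  indicator-*-true : ∀ {p} {Q : Set p} (Q? : Dec Q) {z} → Q → indicator Q? * z ≈ z
  indicator-*-true Q? q = ≈-trans (*-congʳ (indicator-true Q? q)) (*-identityˡ _)

  indicator-*-false : ∀ {p} {Q : Set p} (Q? : Dec Q) {z} → ¬ Q → indicator Q? * z ≈ 0ℂ
  indicator-*-false Q? ¬q = ≈-trans (*-congʳ (indicator-false Q? ¬q)) (zeroˡ _)

  -- The relations `c h` partition G × G, so only h = x⁻¹y contributes at (x,y).
  combination-entry : ∀ {γ} → γ Preserves G._≈_ ⟶ _≈_ → ∀ W x y → combination γ W x y ≈ γ (x G.\\ y) * W x y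
  combination-entry {γ} γ-cong W x y = ∑-single (x G.\\ y)
    (λ h x\\y≈h → *-cong (γ-cong (G.sym x\\y≈h)) (indicator-*-true (x G.∙ h G.≟ y) (x\\y≈h⇒x∙h≈y x\\y≈h)))
    (λ h x\\y≉h → ≈-trans (*-congˡ (indicator-*-false (x G.∙ h G.≟ y) (λ xh≈y → x\\y≉h (x∙h≈y⇒x\\y≈h xh≈y)))) (zeroʳ _))

  private
    Cong : Matrix → Set _
    Cong M = ∀ {x x′ y y′} → x G.≈ x′ → y G.≈ y′ → M x y ≈ M x′ y′

  combination-cong : ∀ {γ W} → γ Preserves G._≈_ ⟶ _≈_ → Cong W → Cong (combination γ W)
  combination-cong {γ} {W} γ-cong W-cong {x} {x′} {y} {y′} x≈ y≈ = begin
    combination γ W x y         ≈⟨ combination-entry γ-cong W x y ⟩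
    γ (x G.\\ y) * W x y        ≈⟨ *-cong (γ-cong (\\-cong₂ x≈ y≈)) (W-cong x≈ y≈) ⟩
    γ (x′ G.\\ y′) * W x′ y′    ≈⟨ combination-entry γ-cong W x′ y′ ⟨
    combination γ W x′ y′       ∎

  -- All factors except the combination are monomial matrices, so each of the four sums has a single
  -- surviving term; they are collapsed from the left.
  transform-entry : ∀ a γ σ {W} → Cong W → ∀ x y → let τ = Inverse.from σ in
    transform a γ σ W x y ≈ value a x ⁻¹ * combination (value γ) W (τ x) (τ y) * value a y
  transform-entry a γ σ {W} W-cong x y = begin
    transform a γ σ W x y                                           ≈⟨ ∑-single y
      (λ z y≈z → *-cong (M₃-entry z) (≈-trans (indicator-*-true (z G.≟ y) (G.sym y≈z)) (ℂˣ-Valued.cong a (G.sym y≈z)))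
        ⟨≈⟩ *-congʳ (*-congˡ (C-cong G.refl (S.from-cong (G.sym y≈z)))))
      (λ z y≉z → ≈-trans (*-congˡ (indicator-*-false (z G.≟ y) (λ z≈y → y≉z (G.sym z≈y)))) (zeroʳ _)) ⟩
    value a x ⁻¹ * C (S.from x) (S.from y) * value a y              ∎
    where
    module S = Inverse σ
    C = combination (value γ) W
    C-cong : Cong C
    C-cong = combination-cong {γ = value γ} {W} (ℂˣ-Valued.cong γ) W-cong
    infixr 2 _⟨≈⟩_
    _⟨≈⟩_ = ≈-trans
    D = diag (λ x → value a x ⁻¹)
    M₁-entry : ∀ z → (D ⊗ P⁻¹ σ) x z ≈ value a x ⁻¹ * P⁻¹ σ x z
    M₁-entry z = ∑-single x
      (λ u x≈u → *-cong (indicator-*-true (x G.≟ u) x≈u)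
        (indicator-cong (S.from u G.≟ z) (S.from x G.≟ z) (G.trans (S.from-cong x≈u)) (G.trans (S.from-cong (G.sym x≈u)))))
      (λ u x≉u → ≈-trans (*-congʳ (indicator-*-false (x G.≟ u) x≉u)) (zeroˡ _))
    M₂-entry : ∀ z → (D ⊗ P⁻¹ σ ⊗ C) x z ≈ value a x ⁻¹ * C (S.from x) z
    M₂-entry z = ∑-single (S.from x)
      (λ u x≈u → *-cong (M₁-entry u ⟨≈⟩ *-congˡ (indicator-true (S.from x G.≟ u) x≈u) ⟨≈⟩ *-identityʳ _) (C-cong (G.sym x≈u) G.refl))
      (λ u x≉u → *-congʳ (M₁-entry u ⟨≈⟩ *-congˡ (indicator-false (S.from x G.≟ u) x≉u) ⟨≈⟩ zeroʳ _) ⟨≈⟩ zeroˡ _)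
    M₃-entry : ∀ z → (D ⊗ P⁻¹ σ ⊗ C ⊗ P σ) x z ≈ value a x ⁻¹ * C (S.from x) (S.from z)
    M₃-entry z = ∑-single (S.from z)
      (λ u z≈u → *-cong (M₂-entry u ⟨≈⟩ *-congˡ (C-cong G.refl (G.sym z≈u))) (indicator-true (S.to u G.≟ z) (S.inverseˡ (G.sym z≈u))) ⟨≈⟩ *-identityʳ _)
      (λ u z≉u → *-congˡ (indicator-false (S.to u G.≟ z) (λ σu≈z → z≉u (S.inverseʳ (G.sym σu≈z)))) ⟨≈⟩ zeroʳ _)

-- Twisted kernels, cocycles and gauge equivalence.

-- Matrices with entries in an abelian group A instead of ℂˣ.
module Kernels {a ℓa g ℓg} (A : AbelianGroup a ℓa) (𝔾 : Group g ℓg) where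

  private module G = Group 𝔾
  open G using () renaming (Carrier to G)
  open GroupTranslations 𝔾
  open AbelianGroup A
  open AbelianGroupSolver A using (solve; solveFrom; _⊕_; _⊖_; inv; one)

  Kernel : Set (a ⊔ g)
  Kernel = G → G → Carrier

  Congruent₁ : (G → Carrier) → Set (ℓa ⊔ g ⊔ ℓg)
  Congruent₁ f = ∀ {x y} → x G.≈ y → f x ≈ f y

  Congruent₂ : Kernel → Set (ℓa ⊔ g ⊔ ℓg)
  Congruent₂ V = ∀ {x x′ y y′} → x G.≈ x′ → y G.≈ y′ → V x y ≈ V x′ y′

  record Function : Set (a ⊔ ℓa ⊔ g ⊔ ℓg) where
    constructor function
    infixl 20 _at_
    field
      _at_    : G → Carrier
      at-cong : Congruent₁ _at_

  open Function public

  -- An automorphism σ of the configuration is a left translation; it is recorded as t = ε^(σ⁻¹).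
  record _≃_ (V V′ : Kernel) : Set (a ⊔ ℓa ⊔ g ⊔ ℓg) where
    field
      b γ   : Function
      t     : G
      entry : ∀ x y → V′ x y ≈ (b at x) ⁻¹ ∙ (γ at (x G.\\ y) ∙ V (t G.∙ x) (t G.∙ y)) ∙ b at y

  infix 4 _≃_

  unit : Function
  unit = function (λ _ → ε) (λ _ → refl)

  infixl 7 _·_
  _·_ : Function → Function → Function
  b · d = function (λ x → b at x ∙ d at x) (λ x≈y → ∙-cong (at-cong b x≈y) (at-cong d x≈y))

  infix 8 _°
  _° : Function → Function
  b ° = function (λ x → (b at x) ⁻¹) (λ x≈y → ⁻¹-cong (at-cong b x≈y))

  shift : Function → G → Function
  shift b t = function (λ x → b at (t G.∙ x)) (λ x≈y → at-cong b (G.∙-congˡ x≈y))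

  ≃-refl : ∀ {V} → Congruent₂ V → V ≃ V
  ≃-refl {V} V-cong = record
    { b = unit ; γ = unit ; t = G.ε
    ; entry = λ x y → trans (V-cong (G.sym (G.identityˡ x)) (G.sym (G.identityˡ y)))
        (solve 1 (λ v → v , inv one ⊕ (one ⊕ v) ⊕ one) ≡.refl (V (G.ε G.∙ x) (G.ε G.∙ y) ∷ []))
    }

  -- Evaluate at t⁻¹x and t⁻¹y and solve for V. Only b is shifted, because left translation
  -- preserves x⁻¹y, the argument of γ.
  ≃-sym : ∀ {V V′} → Congruent₂ V → V ≃ V′ → V′ ≃ V
  ≃-sym {V} {V′} V-cong V≃V′ = record
    { b = shift b (t G.⁻¹) ° ; γ = γ ° ; t = t G.⁻¹
    ; entry = λ x y → let x′ = t G.⁻¹ G.∙ x ; y′ = t G.⁻¹ G.∙ y in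
        solveFrom 5 (λ v′ bₓ γ v bᵧ →
            (inv bₓ ⊕ (γ ⊕ v) ⊕ bᵧ , v′) , (v , inv (inv bₓ) ⊕ (inv γ ⊕ v′) ⊕ inv bᵧ))
          ≡.refl (V′ x′ y′ ∷ b at x′ ∷ γ at (x G.\\ y) ∷ V x y ∷ b at y′ ∷ [])
          (sym (trans (entry x′ y′) (∙-congʳ (∙-congˡ (∙-cong
            (at-cong γ (translated-\\ (t G.⁻¹) x y)) (V-cong (\\-leftDividesˡ t x) (\\-leftDividesˡ t y)))))))
    }
    where open _≃_ V≃V′

  ≃-trans : ∀ {V V′ V″} → Congruent₂ V → V ≃ V′ → V′ ≃ V″ → V ≃ V″
  ≃-trans {V} {V′} {V″} V-cong V≃V′ V′≃V″ = record
    { b = b′ · shift b t′ ; γ = γ · γ′ ; t = t G.∙ t′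
    ; entry = λ x y → let x′ = t′ G.∙ x ; y′ = t′ G.∙ y ; v = V (t G.∙ t′ G.∙ x) (t G.∙ t′ G.∙ y) in trans (entry′ x y)
        (solveFrom 8 (λ b′ₓ γ′ bₓ γ v bᵧ b′ᵧ v′ → (v′ , inv bₓ ⊕ (γ ⊕ v) ⊕ bᵧ)
              , (inv b′ₓ ⊕ (γ′ ⊕ v′) ⊕ b′ᵧ , inv (b′ₓ ⊕ bₓ) ⊕ (γ ⊕ γ′ ⊕ v) ⊕ (b′ᵧ ⊕ bᵧ)))
          ≡.refl (b′ at x ∷ γ′ at (x G.\\ y) ∷ b at x′ ∷ γ at (x G.\\ y) ∷ v ∷ b at y′ ∷ b′ at y ∷ V′ x′ y′ ∷ [])
          (trans (entry x′ y′) (∙-congʳ (∙-congˡ (∙-cong (at-cong γ (translated-\\ t′ x y))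
            (V-cong (G.sym (G.assoc _ _ _)) (G.sym (G.assoc _ _ _))))))))
    }
    where
    open _≃_ V≃V′
    open _≃_ V′≃V″ renaming (b to b′; γ to γ′; t to t′; entry to entry′)

  record IsCocycle (α : Kernel) : Set (ℓa ⊔ g ⊔ ℓg) where
    field
      cong    : Congruent₂ α
      cocycle : ∀ h k l → α h k ∙ α (h G.∙ k) l ≈ α h (k G.∙ l) ∙ α k l

  -- Entrywise form of the relation A_h A_k = α(h,k) A_hk between the matrices weighted by V: their
  -- span is a twisted group algebra.
  TwistedBy : Kernel → Kernel → Set (ℓa ⊔ g ⊔ ℓg)
  TwistedBy α V = ∀ x y z {h k} → x G.∙ h G.≈ y → y G.∙ k G.≈ z → V x y ∙ V y z ≈ α h k ∙ V x z

  -- ⟨ α ⟩ is the matrix W_α.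
  ⟨_⟩ : Kernel → Kernel
  ⟨ α ⟩ x y = α x (x G.\\ y)

  coboundary : Function → Kernel → Kernel
  coboundary γ α h k = γ at h ∙ γ at k ∙ (γ at (h G.∙ k)) ⁻¹ ∙ α h k

  coboundary-cong : ∀ γ {α} → Congruent₂ α → Congruent₂ (coboundary γ α)
  coboundary-cong γ α-cong h≈ k≈ = ∙-cong
    (∙-cong (∙-cong (at-cong γ h≈) (at-cong γ k≈)) (⁻¹-cong (at-cong γ (G.∙-cong h≈ k≈)))) (α-cong h≈ k≈)

  ⟨⟩-cong : ∀ {α} → Congruent₂ α → Congruent₂ ⟨ α ⟩
  ⟨⟩-cong α-cong x≈ y≈ = α-cong x≈ (\\-cong₂ x≈ y≈)

  -- This is the cocycle identity with x in first place: α(x,h) α(xh,k) = α(h,k) α(x,hk).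
  ⟨⟩-twisted : ∀ {α} → IsCocycle α → TwistedBy α ⟨ α ⟩
  ⟨⟩-twisted {α} α-cocycle x y z {h} {k} xh≈y yk≈z = begin
    α x (x G.\\ y) ∙ α y (y G.\\ z)     ≈⟨ ∙-cong (cong G.refl (x∙h≈y⇒x\\y≈h xh≈y)) (cong (G.sym xh≈y) (x∙h≈y⇒x\\y≈h yk≈z)) ⟩
    α x h ∙ α (x G.∙ h) k               ≈⟨ cocycle x h k ⟩
    α x (h G.∙ k) ∙ α h k               ≈⟨ comm _ _ ⟩
    α h k ∙ α x (h G.∙ k)               ≈⟨ ∙-congˡ (cong G.refl (x∙h≈y⇒x\\y≈h (G.trans (G.sym (G.assoc _ _ _)) (G.trans (G.∙-congʳ xh≈y) yk≈z)))) ⟨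
    α h k ∙ α x (x G.\\ z)              ∎
    where
    open IsCocycle α-cocycle
    open SetoidReasoning setoid

  -- Bracket V(1,h) V(h,hk) V(hk,hkl) in the two possible ways; the entries of V cancel because they
  -- are invertible.
  twisted⇒cocycle : ∀ {α V} → Congruent₂ α → TwistedBy α V → IsCocycle α
  twisted⇒cocycle {α} {V} α-cong twisted = record
    { cong    = α-cong
    ; cocycle = λ h k l → let hk = h G.∙ k ; hkl = hk G.∙ l in
        solveFrom 10 (λ αhk αhk,l αh,kl αkl v₁ v₂ v₃ v₁₂ v₂₃ v₁₂₃ →
            ( (αhk ⊕ v₁₂) ⊕ (αhk,l ⊕ v₁₂₃) ⊕ (v₂ ⊕ v₃) ⊕ (v₁ ⊕ v₂₃)
            , (v₁ ⊕ v₂) ⊕ (v₁₂ ⊕ v₃) ⊕ (αkl ⊕ v₂₃) ⊕ (αh,kl ⊕ v₁₂₃))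
            , (αhk ⊕ αhk,l , αh,kl ⊕ αkl))
          ≡.refl (α h k ∷ α hk l ∷ α h (k G.∙ l) ∷ α k l ∷ V G.ε h ∷ V h hk ∷ V hk hkl ∷ V G.ε hk ∷ V h hkl ∷ V G.ε hkl ∷ [])
          (∙-cong (∙-cong (∙-cong
            (sym (twisted G.ε h hk (G.identityˡ h) G.refl))
            (sym (twisted G.ε hk hkl (G.identityˡ hk) G.refl)))
            (twisted h hk hkl G.refl G.refl))
            (twisted G.ε h hkl (G.identityˡ h) (G.sym (G.assoc h k l))))
    }

  twisted⇒≃⟨⟩ : ∀ {α V} → Congruent₂ α → Congruent₂ V → TwistedBy α V → ⟨ α ⟩ ≃ V
  twisted⇒≃⟨⟩ {α} {V} α-cong V-cong twisted = record
    { b = function (V G.ε) (V-cong G.refl) ; γ = unit ; t = G.ε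
    ; entry = λ x y → solveFrom 4 (λ vₓ v α vᵧ → (vₓ ⊕ v , α ⊕ vᵧ) , (v , inv vₓ ⊕ (one ⊕ α) ⊕ vᵧ)) ≡.refl
        (V G.ε x ∷ V x y ∷ ⟨ α ⟩ (G.ε G.∙ x) (G.ε G.∙ y) ∷ V G.ε y ∷ [])
        (trans (twisted G.ε x y (G.identityˡ x) (\\-leftDividesˡ x y))
          (∙-congʳ (⟨⟩-cong α-cong (G.sym (G.identityˡ x)) (G.sym (G.identityˡ y)))))
    }

  -- At (x,xh) the factors γ(x) and γ(xh)⁻¹ depend on one index each and form a diagonal gauge. The
  -- left diagonal factor enters inverted, so b is 1/γ.
  coboundary⇒≃ : ∀ {α β} → Congruent₂ α → ∀ γ → (∀ h k → β h k ≈ coboundary γ α h k) → ⟨ α ⟩ ≃ ⟨ β ⟩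
  coboundary⇒≃ {α} {β} α-cong γ β≈ = record
    { b = γ ° ; γ = γ ; t = G.ε
    ; entry = λ x y → let h = x G.\\ y in trans (β≈ x h)
        (trans (∙-cong (∙-congˡ (⁻¹-cong (at-cong γ (\\-leftDividesˡ x y))))
                       (⟨⟩-cong α-cong (G.sym (G.identityˡ x)) (G.sym (G.identityˡ y))))
          (solve 4 (λ γₓ γₕ γᵧ α → γₓ ⊕ γₕ ⊖ γᵧ ⊕ α , inv (inv γₓ) ⊕ (γₕ ⊕ α) ⊕ inv γᵧ) ≡.refl
            (γ at x ∷ γ at h ∷ γ at y ∷ ⟨ α ⟩ (G.ε G.∙ x) (G.ε G.∙ y) ∷ [])))
    }

  -- With d(x) = b(x) α(t,x), the two cocycle identities force γ(h) d(h) to be constant in h, so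
  -- β/α, which is the coboundary of 1/d up to this constant, is the coboundary of γ.
  ≃⇒coboundary : ∀ {α β} → IsCocycle α → IsCocycle β → (⟨α⟩≃⟨β⟩ : ⟨ α ⟩ ≃ ⟨ β ⟩) →
                 ∀ h k → β h k ≈ coboundary (_≃_.γ ⟨α⟩≃⟨β⟩) α h k
  ≃⇒coboundary {α} {β} α-cocycle β-cocycle ⟨α⟩≃⟨β⟩ = λ h k →
      solveFrom 7 (λ β dₕ γₖ dₕₖ α γₕ γₕₖ →
          (β ⊕ (γₕₖ ⊕ dₕₖ) , inv dₕ ⊕ γₖ ⊕ dₕₖ ⊕ α ⊕ (γₕ ⊕ dₕ)) , (β , γₕ ⊕ γₖ ⊖ γₕₖ ⊕ α))
        ≡.refl (β h k ∷ d h ∷ γ at k ∷ d (h G.∙ k) ∷ α h k ∷ γ at h ∷ γ at (h G.∙ k) ∷ [])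
        (∙-cong (β≈ h k) (constant h k))
    where
    open _≃_ ⟨α⟩≃⟨β⟩
    module α = IsCocycle α-cocycle
    module β = IsCocycle β-cocycle
    d : G → Carrier
    d x = b at x ∙ α t x
    d-cong : Congruent₁ d
    d-cong x≈y = ∙-cong (at-cong b x≈y) (α.cong G.refl x≈y)
    entry′ : ∀ x h → β x h ≈ (b at x) ⁻¹ ∙ (γ at h ∙ α (t G.∙ x) h) ∙ b at (x G.∙ h)
    entry′ x h = begin
      β x h
        ≈⟨ β.cong G.refl (\\-leftDividesʳ x h) ⟨
      β x (x G.\\ (x G.∙ h))
        ≈⟨ entry x (x G.∙ h) ⟩
      (b at x) ⁻¹ ∙ (γ at (x G.\\ (x G.∙ h)) ∙ α (t G.∙ x) ((t G.∙ x) G.\\ (t G.∙ (x G.∙ h)))) ∙ b at (x G.∙ h)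
        ≈⟨ ∙-congʳ (∙-congˡ (∙-cong (at-cong γ (\\-leftDividesʳ x h))
             (α.cong G.refl (G.trans (translated-\\ t x (x G.∙ h)) (\\-leftDividesʳ x h))))) ⟩
      (b at x) ⁻¹ ∙ (γ at h ∙ α (t G.∙ x) h) ∙ b at (x G.∙ h)
        ∎
      where open SetoidReasoning setoid
    -- The cocycle identity at (t,x,h) gives α(tx,h) = α(t,xh) α(x,h) / α(t,x): translation by t
    -- becomes a diagonal factor and is absorbed into d.
    β≈ : ∀ x h → β x h ≈ d x ⁻¹ ∙ γ at h ∙ d (x G.∙ h) ∙ α x h
    β≈ x h = solveFrom 8 (λ β bₓ γ αₜₓ,ₕ bₓₕ αₜₓ αₜ,ₓₕ αₓₕ →
          (β ⊕ (αₜₓ ⊕ αₜₓ,ₕ) , inv bₓ ⊕ (γ ⊕ αₜₓ,ₕ) ⊕ bₓₕ ⊕ (αₜ,ₓₕ ⊕ αₓₕ))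
          , (β , inv (bₓ ⊕ αₜₓ) ⊕ γ ⊕ (bₓₕ ⊕ αₜ,ₓₕ) ⊕ αₓₕ))
        ≡.refl (β x h ∷ b at x ∷ γ at h ∷ α (t G.∙ x) h ∷ b at (x G.∙ h) ∷ α t x ∷ α t (x G.∙ h) ∷ α x h ∷ [])
        (∙-cong (entry′ x h) (α.cocycle t x h))
    constant : ∀ h k → γ at (h G.∙ k) ∙ d (h G.∙ k) ≈ γ at h ∙ d h
    -- Expand the four values of β in its cocycle identity at (1,h,k) by `β≈`. The identity of α at
    -- the same triple removes α, and the remaining factors cancel down to the claim.
    constant h k = solveFrom 17 (λ βₑₕ βₕ,ₖ βₑ,ₕₖ βₕₖ dₑ γₕ dₑₕ αₑₕ γₖ dₑₕ,ₖ αₑₕ,ₖ γₕₖ dₑ,ₕₖ αₑ,ₕₖ dₕ dₕₖ αₕₖ →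
          ( (inv dₑ ⊕ γₕₖ ⊕ dₑ,ₕₖ ⊕ αₑ,ₕₖ) ⊕ (inv dₕ ⊕ γₖ ⊕ dₕₖ ⊕ αₕₖ) ⊕ βₑₕ ⊕ βₕ,ₖ ⊕ (βₑ,ₕₖ ⊕ βₕₖ) ⊕ (αₑₕ ⊕ αₑₕ,ₖ) ⊕ dₑₕ,ₖ
          , βₑ,ₕₖ ⊕ βₕₖ ⊕ (inv dₑ ⊕ γₕ ⊕ dₑₕ ⊕ αₑₕ) ⊕ (inv dₑₕ ⊕ γₖ ⊕ dₑₕ,ₖ ⊕ αₑₕ,ₖ) ⊕ (βₑₕ ⊕ βₕ,ₖ) ⊕ (αₑ,ₕₖ ⊕ αₕₖ) ⊕ dₑ,ₕₖ)
          , (γₕₖ ⊕ dₕₖ , γₕ ⊕ dₕ))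
        ≡.refl (β G.ε h ∷ β (G.ε G.∙ h) k ∷ β G.ε (h G.∙ k) ∷ β h k ∷ d G.ε ∷ γ at h ∷ d (G.ε G.∙ h) ∷ α G.ε h
          ∷ γ at k ∷ d (G.ε G.∙ h G.∙ k) ∷ α (G.ε G.∙ h) k ∷ γ at (h G.∙ k) ∷ d (G.ε G.∙ (h G.∙ k)) ∷ α G.ε (h G.∙ k)
          ∷ d h ∷ d (h G.∙ k) ∷ α h k ∷ [])
        (∙-cong (∙-cong (∙-cong (∙-cong (∙-cong (∙-cong
          (sym (β≈ G.ε (h G.∙ k))) (sym (β≈ h k))) (β≈ G.ε h)) (β≈ (G.ε G.∙ h) k))
          (sym (β.cocycle G.ε h k))) (α.cocycle G.ε h k)) (d-cong (G.assoc G.ε h k)))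

  gauge : Function → Function → Kernel → Kernel
  gauge b γ V x y = (b at x) ⁻¹ ∙ (γ at (x G.\\ y) ∙ V x y) ∙ b at y

  gauge-cong : ∀ b γ {V} → Congruent₂ V → Congruent₂ (gauge b γ V)
  gauge-cong b γ V-cong x≈ y≈ = ∙-cong (∙-cong (⁻¹-cong (at-cong b x≈))
    (∙-cong (at-cong γ (\\-cong₂ x≈ y≈)) (V-cong x≈ y≈))) (at-cong b y≈)

  ≃-gauge : ∀ b γ {V} → Congruent₂ V → V ≃ gauge b γ V
  ≃-gauge b γ V-cong = record
    { b = b ; γ = γ ; t = G.ε
    ; entry = λ x y → ∙-congʳ (∙-congˡ (∙-congˡ (V-cong (G.sym (G.identityˡ x)) (G.sym (G.identityˡ y)))))
    }

  -- The diagonal factors telescope along x, y, z, while γ contributes γ(h) γ(k) / γ(hk) to the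
  -- multiplier.
  gauge-twisted : ∀ b γ {α V} → TwistedBy α V → TwistedBy (coboundary γ α) (gauge b γ V)
  gauge-twisted b γ {α} {V} twisted x y z {h} {k} xh≈y yk≈z =
    solveFrom 13 (λ v₁ v₂ v₃ α γ₁ γ₂ γ₃ γₕ γₖ γₕₖ bₓ bᵧ b₂ →
        ((v₁ ⊕ v₂) ⊕ γ₁ ⊕ γ₂ ⊕ γₕₖ , (α ⊕ v₃) ⊕ γₕ ⊕ γₖ ⊕ γ₃)
        , ( (inv bₓ ⊕ (γ₁ ⊕ v₁) ⊕ bᵧ) ⊕ (inv bᵧ ⊕ (γ₂ ⊕ v₂) ⊕ b₂)
          , (γₕ ⊕ γₖ ⊖ γₕₖ ⊕ α) ⊕ (inv bₓ ⊕ (γ₃ ⊕ v₃) ⊕ b₂)))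
      ≡.refl (V x y ∷ V y z ∷ V x z ∷ α h k ∷ γ at (x G.\\ y) ∷ γ at (y G.\\ z) ∷ γ at (x G.\\ z)
        ∷ γ at h ∷ γ at k ∷ γ at (h G.∙ k) ∷ b at x ∷ b at y ∷ b at z ∷ [])
      (∙-cong (∙-cong (∙-cong (twisted x y z xh≈y yk≈z)
        (at-cong γ (x∙h≈y⇒x\\y≈h xh≈y))) (at-cong γ (x∙h≈y⇒x\\y≈h yk≈z)))
        (at-cong γ (G.sym (x∙h≈y⇒x\\y≈h (G.trans (G.sym (G.assoc x h k)) (G.trans (G.∙-congʳ xh≈y) yk≈z))))))

  -- The value forced on the twisting factor at x = 1. A factor merely supplied for each pair h, k
  -- need not respect equality in G; this expression in V does.
  multiplier : Kernel → Kernel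
  multiplier V h k = V G.ε h ∙ V h (h G.∙ k) ∙ V G.ε (h G.∙ k) ⁻¹

  multiplier-cong : ∀ {V} → Congruent₂ V → Congruent₂ (multiplier V)
  multiplier-cong V-cong p q =
    ∙-cong (∙-cong (V-cong G.refl p) (V-cong p (G.∙-cong p q))) (⁻¹-cong (V-cong G.refl (G.∙-cong p q)))

  multiplier-twisted : ∀ {V} →
    (∀ h k → ∃[ m ] ∀ {x y z} → x G.∙ h G.≈ y → y G.∙ k G.≈ z → V x y ∙ V y z ≈ m ∙ V x z) →
    TwistedBy (multiplier V) V
  multiplier-twisted {V} homogeneous x y z {h} {k} xh≈y yk≈z =
    solveFrom 7 (λ m xy yz xz e₁ e₂ e₃ →
        ((xy ⊕ yz) ⊕ (m ⊕ e₃) , (m ⊕ xz) ⊕ (e₁ ⊕ e₂)) , (xy ⊕ yz , e₁ ⊕ e₂ ⊖ e₃ ⊕ xz)) ≡.refl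
      (proj₁ (homogeneous h k) ∷ V x y ∷ V y z ∷ V x z ∷ V G.ε h ∷ V h (h G.∙ k) ∷ V G.ε (h G.∙ k) ∷ [])
      (∙-cong (proj₂ (homogeneous h k) xh≈y yk≈z) (sym (proj₂ (homogeneous h k) (G.identityˡ h) G.refl)))

-- Making kernels and equivalences unitary.

-- What the theorem uses of A = ℂˣ, B = ℝ₊ and the homomorphism z ↦ |z|².
record Polar {a ℓa b ℓb} (A : AbelianGroup a ℓa) (B : AbelianGroup b ℓb) : Set (a ⊔ ℓa ⊔ b ⊔ ℓb) where
  private
    module A = AbelianGroup A
    module B = AbelianGroup B
  open Mult B.commutativeMonoid using () renaming (_×_ to _×⁺_)
  field
    ∣_∣         : A.Carrier → B.Carrier
    ∣∣-cong     : ∀ {z w} → z A.≈ w → ∣ z ∣ B.≈ ∣ w ∣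
    ∣∣-∙        : ∀ z w → ∣ z A.∙ w ∣ B.≈ ∣ z ∣ B.∙ ∣ w ∣
    surjective  : ∀ p → ∃[ z ] ∣ z ∣ B.≈ p
    ×-injective : ∀ n .{{_ : NonZero n}} {p q} → n ×⁺ p B.≈ n ×⁺ q → p B.≈ q
    root        : ∀ n .{{_ : NonZero n}} p → ∃[ s ] n ×⁺ s B.≈ p
    √           : A.Carrier → A.Carrier
    √-cong      : ∀ {z w} → z A.≈ w → √ z A.≈ √ w
    √-square    : ∀ z → ∣ z ∣ B.≈ B.ε → √ z A.∙ √ z A.≈ z
    √-ε         : √ A.ε A.≈ A.ε

module UnitaryKernels {a ℓa b₀ ℓb g ℓg} {A : AbelianGroup a ℓa} {B : AbelianGroup b₀ ℓb}
  (polar : Polar A B) (𝔾 : FiniteGroup g ℓg) where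

  private
    module G = FiniteGroup 𝔾
    module B = AbelianGroup B
    module SA = AbelianGroupSolver A
    module SB = AbelianGroupSolver B
  open G using () renaming (Carrier to G)
  open FiniteGroupProperties 𝔾
  open AbelianGroup A
  open Polar polar
  open Kernels A G.group
  open Mult B.commutativeMonoid using (×-idem; ×-distrib-+) renaming (_×_ to _×⁺_)
  open GroupSum B.commutativeMonoid 𝔾

  private
    instance
      nonZero : NonZero G.order
      nonZero = order-nonZero

  ∣ε∣≈ε : ∣ ε ∣ B.≈ B.ε
  ∣ε∣≈ε = AbelianGroupProperties.identityˡ-unique B ∣ ε ∣ ∣ ε ∣ (B.trans (B.sym (∣∣-∙ ε ε)) (∣∣-cong (identityˡ ε)))

  ∣⁻¹∣ : ∀ z → ∣ z ⁻¹ ∣ B.≈ ∣ z ∣ B.⁻¹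
  ∣⁻¹∣ z = AbelianGroupProperties.inverseˡ-unique B ∣ z ⁻¹ ∣ ∣ z ∣
    (B.trans (B.sym (∣∣-∙ (z ⁻¹) z)) (B.trans (∣∣-cong (inverseˡ z)) ∣ε∣≈ε))

  ∣√∣≈ε : ∀ {z} → ∣ z ∣ B.≈ B.ε → ∣ √ z ∣ B.≈ B.ε
  ∣√∣≈ε {z} ∣z∣≈ε = ×-injective 2 (B.trans (SB.solveFrom 2 (λ r z → (r SB.⊕ r , z) , (r SB.⊕ (r SB.⊕ SB.one) , z)) ≡.refl
      (∣ √ z ∣ ∷ ∣ z ∣ ∷ []) (B.trans (B.sym (∣∣-∙ (√ z) (√ z))) (∣∣-cong (√-square z ∣z∣≈ε))))
    (B.trans ∣z∣≈ε (SB.solve 0 (SB.one , SB.one SB.⊕ (SB.one SB.⊕ SB.one)) ≡.refl [])))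

  ∣gauge∣ : ∀ b γ V x y → ∣ gauge b γ V x y ∣ B.≈ ∣ b at x ∣ B.⁻¹ B.∙ (∣ γ at (x G.\\ y) ∣ B.∙ ∣ V x y ∣) B.∙ ∣ b at y ∣
  ∣gauge∣ b γ V x y = B.trans (∣∣-∙ _ _) (B.∙-congʳ (B.trans (∣∣-∙ _ _) (B.∙-cong (∣⁻¹∣ _) (∣∣-∙ _ _))))

  Unimodular₁ : Function → Set (ℓb ⊔ g)
  Unimodular₁ f = ∀ x → ∣ f at x ∣ B.≈ B.ε

  Unimodular₂ : Kernel → Set (ℓb ⊔ g)
  Unimodular₂ V = ∀ x y → ∣ V x y ∣ B.≈ B.ε

  -- For numbers of modulus 1 conjugation is inversion, so the hermitian condition can be stated
  -- inside the group.
  record IsUnitary (V : Kernel) : Set (ℓa ⊔ ℓb ⊔ g) where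
    field
      unimodular : Unimodular₂ V
      diagonal   : ∀ x → V x x ≈ ε
      hermitian  : ∀ x y → V x y ∙ V y x ≈ ε

  -- Comparing the products over x of both sides of |b(x)| = |γ(h)| |b(xh)|.
  ∣γ∣≈ε : ∀ b γ → (∀ x h → ∣ b at x ∣ B.≈ ∣ γ at h ∣ B.∙ ∣ b at (x G.∙ h) ∣) → Unimodular₁ γ
  ∣γ∣≈ε b γ eq h = ×-injective G.order (B.trans
    (AbelianGroupProperties.identityˡ-unique B (G.order ×⁺ ∣ γ at h ∣) (∑ (λ x → ∣ b at x ∣)) (begin
      G.order ×⁺ ∣ γ at h ∣ B.∙ ∑ (λ x → ∣ b at x ∣)
        ≈⟨ B.∙-cong (B.sym (∑-const _)) (∑-reindex (rightTranslation h) (λ x≈y → ∣∣-cong (at-cong b x≈y))) ⟩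
      ∑ (λ _ → ∣ γ at h ∣) B.∙ ∑ (λ x → ∣ b at (x G.∙ h) ∣)
        ≈⟨ ∑-distrib (λ _ → ∣ γ at h ∣) (λ x → ∣ b at (x G.∙ h) ∣) ⟨
      ∑ (λ x → ∣ γ at h ∣ B.∙ ∣ b at (x G.∙ h) ∣)
        ≈⟨ ∑-cong (λ x → eq x h) ⟨
      ∑ (λ x → ∣ b at x ∣)
        ∎))
    (B.sym (×-idem (B.identityˡ B.ε) G.order)))
    where open SetoidReasoning B.setoid

  record _≃ᵁ_ (V V′ : Kernel) : Set (a ⊔ ℓa ⊔ ℓb ⊔ g ⊔ ℓg) where
    field
      V≃V′ : V ≃ V′
    open _≃_ V≃V′ public
    field
      b-unimodular : Unimodular₁ b
      γ-unimodular : Unimodular₁ γ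
      γ-hermitian  : ∀ h → γ at (h G.⁻¹) ≈ (γ at h) ⁻¹

  infix 4 _≃ᵁ_

  -- All entries have modulus 1, so |b(x)| = |γ(h)| |b(xh)|. This makes γ unimodular and then |b|
  -- constant, and dividing b by b(1) leaves the transformation unchanged.
  ≃⇒≃ᵁ : ∀ {V V′} → IsUnitary V → IsUnitary V′ → V ≃ V′ → V ≃ᵁ V′
  ≃⇒≃ᵁ {V} {V′} V-unitary V′-unitary V≃V′ = record
    { V≃V′ = record
      { b = b · constant ((b at G.ε) ⁻¹) ; γ = γ ; t = t
      ; entry = λ x y → trans (entry x y)
          (SA.solve 4 (λ bₓ w bᵧ b₀ → SA.inv bₓ SA.⊕ w SA.⊕ bᵧ , SA.inv (bₓ SA.⊕ SA.inv b₀) SA.⊕ w SA.⊕ (bᵧ SA.⊕ SA.inv b₀)) ≡.refl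
            (b at x ∷ γ at (x G.\\ y) ∙ V (t G.∙ x) (t G.∙ y) ∷ b at y ∷ b at G.ε ∷ []))
      }
    ; b-unimodular = λ x → B.trans (∣∣-∙ _ _) (B.trans (B.∙-cong (∣b∣≈∣bε∣ x) (∣⁻¹∣ _)) (B.inverseʳ _))
    ; γ-unimodular = γ-unimodular
    -- In the product of the entries at (1,h) and (h,1) the factors b cancel, and the hermitian
    -- conditions on both kernels leave γ(h) γ(h⁻¹) = 1.
    ; γ-hermitian  = λ h → let h̄ = h G.⁻¹ ; e = G.ε ; te = t G.∙ e ; th = t G.∙ h in
        SA.solveFrom 8 (λ v′ v̄′ γ γ̄ v v̄ bₑ bₕ →
            ( (SA.inv bₑ SA.⊕ (γ SA.⊕ v) SA.⊕ bₕ) SA.⊕ (SA.inv bₕ SA.⊕ (γ̄ SA.⊕ v̄) SA.⊕ bₑ) SA.⊕ (v′ SA.⊕ v̄′)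
            , v′ SA.⊕ v̄′ SA.⊕ (v SA.⊕ v̄))
            , (γ̄ , SA.inv γ)) ≡.refl
          (V′ e h ∷ V′ h e ∷ γ at h ∷ γ at h̄ ∷ V te th ∷ V th te ∷ b at e ∷ b at h ∷ [])
          (sym (∙-cong (∙-cong
            (trans (entry e h) (∙-congʳ (∙-congˡ (∙-congʳ (at-cong γ (x∙h≈y⇒x\\y≈h (G.identityˡ h)))))))
            (trans (entry h e) (∙-congʳ (∙-congˡ (∙-congʳ (at-cong γ (G.identityʳ h̄)))))))
            (trans (U.hermitian te th) (sym (U′.hermitian e h)))))
    }
    where
    open _≃_ V≃V′
    module U = IsUnitary V-unitary
    module U′ = IsUnitary V′-unitary
    constant : Carrier → Function
    constant z = function (λ _ → z) (λ _ → refl)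
    norms : ∀ x h → ∣ b at x ∣ B.≈ ∣ γ at h ∣ B.∙ ∣ b at (x G.∙ h) ∣
    norms x h = SB.solveFrom 5 (λ v′ bₓ γ v bᵧ →
          (v′ SB.⊕ v , SB.inv bₓ SB.⊕ (γ SB.⊕ v) SB.⊕ bᵧ SB.⊕ v′) , (bₓ , γ SB.⊕ bᵧ)) ≡.refl
        (∣ V′ x y ∣ ∷ ∣ b at x ∣ ∷ ∣ γ at h ∣ ∷ ∣ V (t G.∙ x) (t G.∙ y) ∣ ∷ ∣ b at y ∣ ∷ [])
        (B.∙-cong (B.trans (∣∣-cong (entry x y)) (B.trans (∣∣-∙ _ _) (B.∙-congʳ (B.trans (∣∣-∙ _ _) (B.∙-cong (∣⁻¹∣ _)
          (B.trans (∣∣-∙ _ _) (B.∙-congʳ (∣∣-cong (at-cong γ (\\-leftDividesʳ x h))))))))))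
          (B.trans (U.unimodular (t G.∙ x) (t G.∙ y)) (B.sym (U′.unimodular x y))))
      where y = x G.∙ h
    γ-unimodular : Unimodular₁ γ
    γ-unimodular = ∣γ∣≈ε b γ norms
    ∣b∣≈∣bε∣ : ∀ x → ∣ b at x ∣ B.≈ ∣ b at G.ε ∣
    ∣b∣≈∣bε∣ x = B.sym (B.trans (norms G.ε x)
      (B.trans (B.∙-cong (γ-unimodular x) (∣∣-cong (at-cong b (G.identityˡ x)))) (B.identityˡ _)))

  -- H²(G, ℝ₊) is trivial: the product over l of the cocycle identity makes |α|^|G| the coboundary of
  -- ρ(h) = ∏ₗ |α(h,l)|, and |G|-th roots exist.
  ∃-modulus : ∀ {α} → IsCocycle α →
              ∃[ κ ] ∀ h k → ∣ α h k ∣ B.∙ ∣ κ at (h G.∙ k) ∣ B.≈ ∣ κ at h ∣ B.∙ ∣ κ at k ∣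
  ∃-modulus {α} α-cocycle = function κ κ-cong , λ h k → ×-injective G.order (begin
      n ×⁺ (∣ α h k ∣ B.∙ ∣ κ (h G.∙ k) ∣)        ≈⟨ ×-distrib-+ _ _ n ⟩
      n ×⁺ ∣ α h k ∣ B.∙ n ×⁺ ∣ κ (h G.∙ k) ∣     ≈⟨ B.∙-congˡ (κ-root (h G.∙ k)) ⟩
      n ×⁺ ∣ α h k ∣ B.∙ ρ (h G.∙ k)              ≈⟨ product h k ⟩
      ρ h B.∙ ρ k                                 ≈⟨ B.∙-cong (κ-root h) (κ-root k) ⟨
      n ×⁺ ∣ κ h ∣ B.∙ n ×⁺ ∣ κ k ∣               ≈⟨ ×-distrib-+ _ _ n ⟨
      n ×⁺ (∣ κ h ∣ B.∙ ∣ κ k ∣)                  ∎)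
    where
    open IsCocycle α-cocycle
    open SetoidReasoning B.setoid
    n = G.order
    ρ : G → B.Carrier
    ρ h = ∑ (λ l → ∣ α h l ∣)
    ρ-cong : ∀ {h k} → h G.≈ k → ρ h B.≈ ρ k
    ρ-cong h≈k = ∑-cong (λ l → ∣∣-cong (cong h≈k (G.refl {l})))
    product : ∀ h k → n ×⁺ ∣ α h k ∣ B.∙ ρ (h G.∙ k) B.≈ ρ h B.∙ ρ k
    product h k = begin
      n ×⁺ ∣ α h k ∣ B.∙ ρ (h G.∙ k)                        ≈⟨ B.∙-congʳ (∑-const _) ⟨
      ∑ (λ _ → ∣ α h k ∣) B.∙ ρ (h G.∙ k)                   ≈⟨ ∑-distrib (λ _ → ∣ α h k ∣) (λ l → ∣ α (h G.∙ k) l ∣) ⟨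
      ∑ (λ l → ∣ α h k ∣ B.∙ ∣ α (h G.∙ k) l ∣)             ≈⟨ ∑-cong (λ l → B.trans (B.sym (∣∣-∙ _ _)) (B.trans (∣∣-cong (cocycle h k l)) (∣∣-∙ _ _))) ⟩
      ∑ (λ l → ∣ α h (k G.∙ l) ∣ B.∙ ∣ α k l ∣)             ≈⟨ ∑-distrib (λ l → ∣ α h (k G.∙ l) ∣) (λ l → ∣ α k l ∣) ⟩
      ∑ (λ l → ∣ α h (k G.∙ l) ∣) B.∙ ρ k                   ≈⟨ B.∙-congʳ (∑-reindex (leftTranslation k) (λ l≈m → ∣∣-cong (cong G.refl l≈m))) ⟨
      ρ h B.∙ ρ k                                           ∎
    -- Only the modulus of κ(h) is prescribed, so an arbitrary choice of phases could fail to
    -- respect equality in G.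
    choice = choose {_∼_ = _≈_} reflexive (λ h z → n ×⁺ ∣ z ∣ B.≈ ρ h) (λ h≈k p → B.trans p (ρ-cong h≈k))
      (λ h → let (s , ns≈ρ) = root n (ρ h) ; (z , ∣z∣≈s) = surjective s in
        z , B.trans (Mult.×-congʳ B.commutativeMonoid n ∣z∣≈s) ns≈ρ)
    κ : G → Carrier
    κ = proj₁ choice
    κ-cong : Congruent₁ κ
    κ-cong = proj₁ (proj₂ choice)
    κ-root : ∀ h → n ×⁺ ∣ κ h ∣ B.≈ ρ h
    κ-root = proj₂ (proj₂ choice)

  -- The factor 1/V(1,x) in b turns V back into W_α; the factors κ then multiply |α(x,h)| by |κ(xh)|
  -- / (|κ(x)| |κ(h)|), which gives 1.
  ∃-unimodular : ∀ {α V} → Congruent₂ α → Congruent₂ V → TwistedBy α V → ∃[ b ] ∃[ γ ] Unimodular₂ (gauge b γ V)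
  ∃-unimodular {α} {V} α-cong V-cong twisted =
      b , κ ° , λ x y → let h = x G.\\ y in
        B.trans (∣gauge∣ b (κ °) V x y) (B.trans
          (B.∙-cong (B.∙-cong (B.⁻¹-cong (B.trans (∣∣-∙ _ _) (B.∙-congʳ (∣⁻¹∣ _)))) (B.∙-congʳ (∣⁻¹∣ _))) (B.trans (∣∣-∙ _ _) (B.∙-congʳ (∣⁻¹∣ _))))
          (SB.solveFrom 7 (λ α κₓ κₕ κᵧ vₓ v vᵧ →
              ( (vₓ SB.⊕ v) SB.⊕ (α SB.⊕ κᵧ) , (α SB.⊕ vᵧ) SB.⊕ (κₓ SB.⊕ κₕ))
              , (SB.inv (SB.inv vₓ SB.⊕ κₓ) SB.⊕ (SB.inv κₕ SB.⊕ v) SB.⊕ (SB.inv vᵧ SB.⊕ κᵧ) , SB.one)) ≡.refl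
            (∣ α x h ∣ ∷ ∣ κ at x ∣ ∷ ∣ κ at h ∣ ∷ ∣ κ at y ∣ ∷ ∣ V G.ε x ∣ ∷ ∣ V x y ∣ ∷ ∣ V G.ε y ∣ ∷ [])
            (B.∙-cong (B.trans (B.sym (∣∣-∙ _ _)) (B.trans (∣∣-cong (twisted G.ε x y (G.identityˡ x) (\\-leftDividesˡ x y))) (∣∣-∙ _ _)))
              (B.trans (B.∙-congˡ (∣∣-cong (at-cong κ (G.sym (\\-leftDividesˡ x y))))) (κ-modulus x h)))))
    where
    modulus = ∃-modulus (twisted⇒cocycle α-cong twisted)
    κ = proj₁ modulus
    κ-modulus = proj₂ modulus
    b : Function
    b = function (V G.ε) (V-cong G.refl) ° · κ

  -- With c = α(ε,ε), unitarity of γV means γ(ε) = 1/c and γ(h) γ(h⁻¹) = 1/(c α(h,h⁻¹)).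
  ∃-unitary : ∀ {α V} → Congruent₂ α → TwistedBy α V → Unimodular₂ V → ∃[ γ ] IsUnitary (gauge unit γ V)
  ∃-unitary {α} {V} α-cong twisted V-unimodular = γ , record
    { unimodular = λ x y → B.trans (∣gauge∣ unit γ V x y) (B.trans
        (B.∙-cong (B.∙-cong (B.⁻¹-cong ∣ε∣≈ε) (B.∙-cong (γ-unimodular (x G.\\ y)) (V-unimodular x y))) ∣ε∣≈ε)
        (SB.solve 0 (SB.inv SB.one SB.⊕ (SB.one SB.⊕ SB.one) SB.⊕ SB.one , SB.one) ≡.refl []))
    ; diagonal   = λ x → begin
        ε ⁻¹ ∙ (γ at (x G.\\ x) ∙ V x x) ∙ ε    ≈⟨ ∙-congʳ (∙-congˡ (∙-cong (trans (at-cong γ (G.inverseˡ x)) γε≈c⁻¹) (V-diagonal x))) ⟩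
        ε ⁻¹ ∙ (c ⁻¹ ∙ c) ∙ ε                   ≈⟨ SA.solve 1 (λ c → SA.inv SA.one SA.⊕ (SA.inv c SA.⊕ c) SA.⊕ SA.one , SA.one) ≡.refl (c ∷ []) ⟩
        ε                                       ∎
    ; hermitian  = λ x y → let h = x G.\\ y in
        SA.solveFrom 8 (λ c α s s̄ γ γ̄ v v̄ →
            ( (s SA.⊕ s) SA.⊕ (v SA.⊕ v̄) SA.⊕ γ̄ SA.⊕ s̄ SA.⊕ γ
            , (c SA.⊕ SA.inv α) SA.⊕ (α SA.⊕ c) SA.⊕ (SA.inv c SA.⊕ s̄) SA.⊕ s SA.⊕ (SA.inv c SA.⊕ s))
            , ((SA.inv SA.one SA.⊕ (γ SA.⊕ v) SA.⊕ SA.one) SA.⊕ (SA.inv SA.one SA.⊕ (γ̄ SA.⊕ v̄) SA.⊕ SA.one) , SA.one)) ≡.refl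
          (c ∷ α h (h G.⁻¹) ∷ √ (q h) ∷ √ (q (h G.⁻¹)) ∷ γ at h ∷ γ at (y G.\\ x) ∷ V x y ∷ V y x ∷ [])
          (∙-cong (∙-cong (∙-cong (∙-cong (√-square (q h) (q-unimodular h)) (opposite x y)) (at-cong γ (G.sym (\\-⁻¹ x y))))
            (√-cong (q-symmetric h))) (refl {γ at h}))
    }
    where
    open SetoidReasoning setoid
    c : Carrier
    c = α G.ε G.ε
    -- γ is split as √q / c so that q(1) = 1. A root of 1/(c α(h,h⁻¹)) taken directly would be a
    -- root of 1/c² at h = 1, with uncontrolled sign.
    q : G → Carrier
    q h = c ∙ α h (h G.⁻¹) ⁻¹
    q-cong : Congruent₁ q
    q-cong h≈k = ∙-congˡ (⁻¹-cong (α-cong h≈k (G.⁻¹-cong h≈k)))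
    γ : Function
    γ = function (λ h → c ⁻¹ ∙ √ (q h)) (λ h≈k → ∙-congˡ (√-cong (q-cong h≈k)))
    V-diagonal : ∀ x → V x x ≈ c
    V-diagonal x = SA.solveFrom 2 (λ v c → (v SA.⊕ v , c SA.⊕ v) , (v , c)) ≡.refl (V x x ∷ c ∷ [])
      (twisted x x x (G.identityʳ x) (G.identityʳ x))
    opposite : ∀ x y → V x y ∙ V y x ≈ α (x G.\\ y) ((x G.\\ y) G.⁻¹) ∙ c
    opposite x y = trans (twisted x y x (\\-leftDividesˡ x y) (G.trans (G.∙-congˡ (\\-⁻¹ x y)) (\\-leftDividesˡ y x))) (∙-congˡ (V-diagonal x))
    -- α(h,h⁻¹) c and α(h⁻¹,h) c both equal V(1,h) V(h,1), read in either order. Hence h and h⁻¹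
    -- receive the same square root.
    q-symmetric : ∀ h → q (h G.⁻¹) ≈ q h
    q-symmetric h = ∙-congˡ (⁻¹-cong (SA.solveFrom 5 (λ α ᾱ c v v̄ → (ᾱ SA.⊕ c SA.⊕ (v SA.⊕ v̄) , v̄ SA.⊕ v SA.⊕ (α SA.⊕ c)) , (ᾱ , α)) ≡.refl
        (α h h̄ ∷ α h̄ (h̄ G.⁻¹) ∷ c ∷ V G.ε h ∷ V h G.ε ∷ [])
        (∙-cong (sym (trans (opposite h G.ε) (∙-congʳ (α-cong (G.identityʳ h̄) (G.⁻¹-cong (G.identityʳ h̄))))))
          (trans (opposite G.ε h) (∙-congʳ (α-cong ε\\h≈h (G.⁻¹-cong ε\\h≈h)))))))
      where
      h̄ = h G.⁻¹
      ε\\h≈h : G.ε G.\\ h G.≈ h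
      ε\\h≈h = x∙h≈y⇒x\\y≈h (G.identityˡ h)
    α-unimodular : ∀ h k → ∣ α h k ∣ B.≈ B.ε
    α-unimodular h k = SB.solveFrom 4 (λ α v₁ v₂ v₃ →
        (α SB.⊕ v₃ SB.⊕ v₁ SB.⊕ v₂ , v₁ SB.⊕ v₂ SB.⊕ SB.one SB.⊕ v₃) , (α , SB.one)) ≡.refl
      (∣ α h k ∣ ∷ ∣ V G.ε h ∣ ∷ ∣ V h (h G.∙ k) ∣ ∷ ∣ V G.ε (h G.∙ k) ∣ ∷ [])
      (B.∙-cong (B.∙-cong (B.trans (B.sym (∣∣-∙ _ _)) (B.trans (∣∣-cong (sym (twisted G.ε h (h G.∙ k) (G.identityˡ h) G.refl))) (∣∣-∙ _ _)))
        (V-unimodular G.ε h)) (B.trans (V-unimodular h (h G.∙ k)) (B.sym (V-unimodular G.ε (h G.∙ k)))))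
    q-unimodular : ∀ h → ∣ q h ∣ B.≈ B.ε
    q-unimodular h = B.trans (∣∣-∙ _ _) (B.trans (B.∙-cong (α-unimodular G.ε G.ε) (B.trans (∣⁻¹∣ _) (B.⁻¹-cong (α-unimodular h (h G.⁻¹)))))
      (B.inverseʳ B.ε))
    γ-unimodular : Unimodular₁ γ
    γ-unimodular h = B.trans (∣∣-∙ _ _) (B.trans
      (B.∙-cong (B.trans (∣⁻¹∣ _) (B.⁻¹-cong (α-unimodular G.ε G.ε))) (∣√∣≈ε (q-unimodular h))) (B.inverseˡ B.ε))
    γε≈c⁻¹ : γ at G.ε ≈ c ⁻¹
    γε≈c⁻¹ = trans (∙-congˡ (trans (√-cong (trans (∙-congˡ (⁻¹-cong (α-cong G.refl ε⁻¹≈ε))) (inverseʳ c))) √-ε)) (identityʳ _)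

-- Weights and factor sets as kernels over ℂˣ.

module Weights {r ℓr₁ ℓr₂ g ℓg} (ℝ : CompleteOrderedField r ℓr₁ ℓr₂) (𝔾 : FiniteGroup g ℓg) where

  private
    module ℝ = CompleteOrderedField ℝ
    module G = FiniteGroup 𝔾
    module T = ThinConfiguration ℝ 𝔾
    module A = AbelianGroup (ComplexField.ℂˣ-group ℝ)
    module ℝ₊ = AbelianGroup (OrderedField.ℝ₊-group ℝ)
  open G using () renaming (Carrier to G)
  open FiniteGroupProperties 𝔾
  open Complex ℝ
  open ComplexField ℝ
  open ThinConfiguration ℝ 𝔾 hiding (c; _^_; P)
  open Entries ℝ 𝔾
  open Kernels ℂˣ-group G.group hiding (⟨_⟩)
  private module K = Kernels ℂˣ-group G.group

  polar : Polar ℂˣ-group (OrderedField.ℝ₊-group ℝ)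
  polar = record
    { ∣_∣         = norm
    ; ∣∣-cong     = norm-cong
    ; ∣∣-∙        = norm-∙
    ; surjective  = ∃-norm
    ; ×-injective = Roots.×-injective ℝ
    ; root        = Roots.∃-root ℝ
    ; √           = √
    ; √-cong      = √-cong
    ; √-square    = √-square
    ; √-ε         = √-ε
    }

  open UnitaryKernels polar 𝔾

  toFunction : ℂˣ-Valued → Function
  toFunction a = function (λ x → value a x , ℂˣ-Valued.nonzero a x) (λ x≈y → ⟨ ℂˣ-Valued.cong a x≈y ⟩)

  fromFunction : Function → ℂˣ-Valued
  fromFunction f = record
    { value   = λ x → number (f at x)
    ; cong    = λ x≈y → ≈-number (at-cong f x≈y)
    ; nonzero = λ x → nonzero (f at x)
    }

  matrix : Kernel → Matrix
  matrix V x y = number (V x y)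

  leftTranslation-isAutomorphism : ∀ t → IsAutomorphism (leftTranslation t)
  leftTranslation-isAutomorphism t h = to , from
    where
    to : ∀ {u v} → (T.c h T.^ leftTranslation t) u v → T.c h u v
    to (x , y , xh≈y , tx≈u , ty≈v) =
      G.trans (G.∙-congʳ (G.sym tx≈u)) (G.trans (G.assoc _ _ _) (G.trans (G.∙-congˡ xh≈y) ty≈v))
    from : ∀ {u v} → T.c h u v → (T.c h T.^ leftTranslation t) u v
    from {u} {v} uh≈v =
      t G.\\ u , t G.\\ v , G.trans (G.assoc _ _ _) (G.∙-congˡ uh≈v) , \\-leftDividesˡ t u , \\-leftDividesˡ t v

  -- With τ inverse to σ, the pair (τ(1), τ(1)x) lies in `c x`, and σ sends it to a pair starting at
  -- 1. Since `c x` is preserved, the second entry of that pair is x.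
  automorphism⇒translation : ∀ σ → IsAutomorphism σ → ∀ x → Inverse.from σ x G.≈ Inverse.from σ G.ε G.∙ x
  automorphism⇒translation σ σ-auto x = begin
    S.from x                              ≈⟨ S.from-cong (G.identityˡ x) ⟨
    S.from (G.ε G.∙ x)                    ≈⟨ S.from-cong (proj₁ (σ-auto x) (S.from G.ε , S.from G.ε G.∙ x , G.refl , S.strictlyInverseˡ G.ε , G.refl)) ⟩
    S.from (S.to (S.from G.ε G.∙ x))      ≈⟨ S.strictlyInverseʳ _ ⟩
    S.from G.ε G.∙ x                      ∎
    where
    module S = Inverse σ
    open SetoidReasoning G.setoid

  -- Stated for any `t` equal to the preimage of 1, to serve both an arbitrary automorphism and the
  -- left translation built from a given t.
  translated-entry : ∀ a γ σ → IsAutomorphism σ → ∀ {W} → (∀ {x x′ y y′} → x G.≈ x′ → y G.≈ y′ → W x y ≈ W x′ y′) →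
    ∀ {t} → Inverse.from σ G.ε G.≈ t → ∀ x y →
    transform a γ σ W x y ≈ value a x ⁻¹ * (value γ (x G.\\ y) * W (t G.∙ x) (t G.∙ y)) * value a y
  translated-entry a γ σ σ-auto {W} W-cong {t} σε≈t x y = begin
    transform a γ σ W x y
      ≈⟨ transform-entry a γ σ W-cong x y ⟩
    value a x ⁻¹ * combination (value γ) W (τ x) (τ y) * value a y
      ≈⟨ *-congʳ (*-congˡ (combination-entry (ℂˣ-Valued.cong γ) W (τ x) (τ y))) ⟩
    value a x ⁻¹ * (value γ (τ x G.\\ τ y) * W (τ x) (τ y)) * value a y
      ≈⟨ *-congʳ (*-congˡ (*-cong (ℂˣ-Valued.cong γ (G.trans (\\-cong₂ (τ≈ x) (τ≈ y)) (translated-\\ t x y))) (W-cong (τ≈ x) (τ≈ y)))) ⟩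
    value a x ⁻¹ * (value γ (x G.\\ y) * W (t G.∙ x) (t G.∙ y)) * value a y ∎
    where
    open SetoidReasoning ℂ-setoid
    τ = Inverse.from σ
    τ≈ : ∀ x → τ x G.≈ t G.∙ x
    τ≈ x = G.trans (automorphism⇒translation σ σ-auto x) (G.∙-congʳ σε≈t)

  ≈ᵂ⇒≃ : ∀ {V V′} → Congruent₂ V → matrix V ≈ᵂ matrix V′ → V ≃ V′
  ≈ᵂ⇒≃ V-cong (a , γ , σ , σ-auto , eq) = record
    { b = toFunction a ; γ = toFunction γ ; t = Inverse.from σ G.ε
    ; entry = λ x y → ⟨ ≈-trans (eq x y) (translated-entry a γ σ σ-auto (λ p q → ≈-number (V-cong p q)) G.refl x y) ⟩
    }

  ≃⇒transform : ∀ {V V′} → Congruent₂ V → (V≃V′ : V ≃ V′) → let open _≃_ V≃V′ in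
    matrix V′ ≈ᴹ transform (fromFunction b) (fromFunction γ) (leftTranslation (t G.⁻¹)) (matrix V)
  ≃⇒transform V-cong V≃V′ x y = ≈-trans (≈-number (entry x y))
    (≈-sym (translated-entry (fromFunction b) (fromFunction γ) (leftTranslation (t G.⁻¹)) (leftTranslation-isAutomorphism (t G.⁻¹))
      (λ p q → ≈-number (V-cong p q)) (G.trans (G.identityʳ _) (⁻¹-involutive t)) x y))
    where open _≃_ V≃V′

  ≃⇒≈ᵂ : ∀ {V V′} → Congruent₂ V → V ≃ V′ → matrix V ≈ᵂ matrix V′
  ≃⇒≈ᵂ V-cong V≃V′ = fromFunction b , fromFunction γ , leftTranslation (t G.⁻¹)
    , leftTranslation-isAutomorphism (t G.⁻¹) , ≃⇒transform V-cong V≃V′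
    where open _≃_ V≃V′

  ≃ᵁ⇒≈ᴴ : ∀ {V V′} → Congruent₂ V → V ≃ᵁ V′ → matrix V ≈ᴴ matrix V′
  ≃ᵁ⇒≈ᴴ V-cong V≃ᵁV′ = fromFunction b , fromFunction γ , leftTranslation (t G.⁻¹)
    , leftTranslation-isAutomorphism (t G.⁻¹) , ≃⇒transform V-cong V≃V′
    , (λ x → norm⇒modulus₁ (b at x) (b-unimodular x))
    , (λ x → norm⇒modulus₁ (γ at x) (γ-unimodular x))
    , (λ h → ≈-number (γ-hermitian h))
    where open _≃ᵁ_ V≃ᵁV′

  twisted⇒weight : ∀ {α V} → Congruent₂ α → Congruent₂ V → TwistedBy α V → IsWeight (matrix V)
  twisted⇒weight {α} {V} α-cong V-cong twisted = record
    { cong       = λ p q → ≈-number (V-cong p q)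
    -- Every h satisfies this predicate, which lives at the universe level that `sptUnion` asks for.
    ; sptUnion   = (λ h → W G.ε h ≉ 0ℂ) , (λ {x} {y} _ → x G.\\ y , nonzero (V G.ε _) , \\-leftDividesˡ x y) , (λ {x} {y} _ → nonzero (V x y))
    ; sptSym     = λ h _ {x} {y} _ → nonzero (V x y)
    ; diagonal   = λ x → nonzero (V x x)
    ; spanClosed = closed
    }
    where
    W = matrix V
    open SetoidReasoning ℂ-setoid
    open CommutativeSemigroupProperties (CommutativeSemiring.*-commutativeSemigroup ℂ-semiring) using (interchange)
    open SemiringSum (CommutativeSemiring.semiring ℂ-semiring) using (*-distribʳ-sum)
    closed : ∀ {M N} → InSpan W M → InSpan W N → InSpan W (M ⊗ N)
    closed {M} {N} (γ , γ-cong , M≈) (δ , δ-cong , N≈) = μ , μ-cong , MN≈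
      where
      -- The term of the twisted convolution γ * δ at k that comes from z.
      F : G → G → ℂ
      F h k = γ h * δ k * number (α h k)
      F-cong : ∀ {h h′ k k′} → h G.≈ h′ → k G.≈ k′ → F h k ≈ F h′ k′
      F-cong p q = *-cong (*-cong (γ-cong p) (δ-cong q)) (≈-number (α-cong p q))
      μ : G → ℂ
      μ k = ∑ (λ z → F z (z G.\\ k))
      μ-cong : μ Preserves G._≈_ ⟶ _≈_
      μ-cong k≈ = ∑-cong (λ z → F-cong (G.refl {z}) (G.∙-congˡ {z G.⁻¹} k≈))
      term : ∀ x y z → M x z * N z y ≈ F (x G.\\ z) (z G.\\ y) * W x y
      term x y z = begin
        M x z * N z y
          ≈⟨ *-cong (≈-trans (M≈ x z) (combination-entry γ-cong W x z)) (≈-trans (N≈ z y) (combination-entry δ-cong W z y)) ⟩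
        (γ h * W x z) * (δ k * W z y)
          ≈⟨ interchange (γ h) (W x z) (δ k) (W z y) ⟩
        γ h * δ k * (W x z * W z y)
          ≈⟨ *-congˡ (≈-number (twisted x z y (\\-leftDividesˡ x z) (\\-leftDividesˡ z y))) ⟩
        γ h * δ k * (number (α h k) * W x y)
          ≈⟨ *-assoc _ _ _ ⟨
        F h k * W x y ∎
        where
        h = x G.\\ z
        k = z G.\\ y
      MN≈ : (M ⊗ N) ≈ᴹ combination μ W
      MN≈ x y = begin
        ∑ (λ z → M x z * N z y)                            ≈⟨ ∑-cong (term x y) ⟩
        ∑ (λ z → F (x G.\\ z) (z G.\\ y) * W x y)          ≈⟨ *-distribʳ-sum (W x y) (λ i → F (x G.\\ G.elementAt i) (G.elementAt i G.\\ y)) ⟨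
        -- Replacing z by xz makes the coefficient a function of x⁻¹y alone.
        ∑ (λ z → F (x G.\\ z) (z G.\\ y)) * W x y          ≈⟨ *-congʳ (∑-reindex (leftTranslation x) (λ z≈ → F-cong (G.∙-congˡ z≈) (\\-cong₂ z≈ G.refl))) ⟩
        ∑ (λ z → F (x G.\\ (x G.∙ z)) ((x G.∙ z) G.\\ y)) * W x y
                                                           ≈⟨ *-congʳ (∑-cong (λ z → F-cong (\\-leftDividesʳ x z) (∙-\\ x z y))) ⟩
        μ (x G.\\ y) * W x y                               ≈⟨ combination-entry μ-cong W x y ⟨
        combination μ W x y                                ∎

  kernel : Weight → Kernel
  kernel (W , _ , W≉0) x y = W x y , W≉0 x y

  kernel-cong : ∀ W → Congruent₂ (kernel W)
  kernel-cong (_ , isWeight , _) p q = ⟨ IsWeight.cong isWeight p q ⟩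

  module _ {W : Matrix} (W-cong : ∀ {x x′ y y′} → x G.≈ x′ → y G.≈ y′ → W x y ≈ W x′ y′) where

    open SetoidReasoning ℂ-setoid

    A[W]-inSpan : ∀ h → InSpan W (A[ W ] h)
    A[W]-inSpan h = δ , δ-cong , λ x y → ≈-trans
        (*-congʳ (indicator-cong (x G.∙ h G.≟ y) (h G.≟ x G.\\ y)
          (λ xh≈y → G.sym (x∙h≈y⇒x\\y≈h xh≈y)) (λ h≈x\\y → x\\y≈h⇒x∙h≈y (G.sym h≈x\\y))))
        (≈-sym (combination-entry δ-cong W x y))
      where
      δ : G → ℂ
      δ k = indicator (h G.≟ k)
      δ-cong : δ Preserves G._≈_ ⟶ _≈_
      δ-cong {k} {l} k≈l = indicator-cong (h G.≟ k) (h G.≟ l) (λ h≈k → G.trans h≈k k≈l) (λ h≈l → G.trans h≈l (G.sym k≈l))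

    ⊗-entry : ∀ {h k x y z} → x G.∙ h G.≈ y → y G.∙ k G.≈ z → ((A[ W ] h) ⊗ (A[ W ] k)) x z ≈ W x y * W y z
    ⊗-entry {h} {k} {x} {y} {z} xh≈y yk≈z = ∑-single y
      (λ u y≈u → *-cong
        (≈-trans (indicator-*-true (x G.∙ h G.≟ u) (G.trans xh≈y y≈u)) (W-cong (G.refl {x}) (G.sym y≈u)))
        (≈-trans (indicator-*-true (u G.∙ k G.≟ z) (G.trans (G.∙-congʳ (G.sym y≈u)) yk≈z)) (W-cong (G.sym y≈u) (G.refl {z}))))
      (λ u y≉u → ≈-trans (*-congʳ (indicator-*-false (x G.∙ h G.≟ u) (λ xh≈u → y≉u (G.trans (G.sym xh≈y) xh≈u)))) (zeroˡ _))

    -- Whatever x is, the entry at (x,z) uses the coefficient at x⁻¹z = hk, so one scalar serves all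
    -- x.
    product-entry : ∀ {h k} ((μ , _) : InSpan W ((A[ W ] h) ⊗ (A[ W ] k))) →
                    ∀ {x y z} → x G.∙ h G.≈ y → y G.∙ k G.≈ z → W x y * W y z ≈ μ (h G.∙ k) * W x z
    product-entry {h} {k} (μ , μ-cong , eq) {x} {y} {z} xh≈y yk≈z = begin
      W x y * W y z                         ≈⟨ ⊗-entry xh≈y yk≈z ⟨
      ((A[ W ] h) ⊗ (A[ W ] k)) x z         ≈⟨ eq x z ⟩
      combination μ W x z                   ≈⟨ combination-entry μ-cong W x z ⟩
      μ (x G.\\ z) * W x z                  ≈⟨ *-congʳ (μ-cong (x∙h≈y⇒x\\y≈h (G.trans (G.sym (G.assoc x h k)) (G.trans (G.∙-congʳ xh≈y) yk≈z)))) ⟩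
      μ (h G.∙ k) * W x z                   ∎

  weight⇒twisted : ∀ W → TwistedBy (multiplier (kernel W)) (kernel W)
  weight⇒twisted weight@(W , isWeight , W≉0) = multiplier-twisted {kernel weight} homogeneous
    where
    open IsWeight isWeight
    factor : ∀ h k (m : ℂ) → (∀ {x y z} → x G.∙ h G.≈ y → y G.∙ k G.≈ z → W x y * W y z ≈ m * W x z) →
             ∃[ m ] ∀ {x y z} → x G.∙ h G.≈ y → y G.∙ k G.≈ z → kernel weight x y A.∙ kernel weight y z A.≈ m A.∙ kernel weight x z
    factor h k m entry = (m , m≉0) , λ xh≈y yk≈z → ⟨ entry xh≈y yk≈z ⟩
      where
      m≉0 : m ≉ 0ℂ
      m≉0 m≈0 = *-nonzero (W≉0 G.ε h) (W≉0 h (h G.∙ k))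
        (≈-trans (entry (G.identityˡ h) G.refl) (≈-trans (*-congʳ m≈0) (zeroˡ _)))
    homogeneous : ∀ h k →
      ∃[ m ] ∀ {x y z} → x G.∙ h G.≈ y → y G.∙ k G.≈ z → kernel weight x y A.∙ kernel weight y z A.≈ m A.∙ kernel weight x z
    homogeneous h k = factor h k (proj₁ inSpan (h G.∙ k)) (product-entry cong inSpan)
      where
      inSpan : InSpan W ((A[ W ] h) ⊗ (A[ W ] k))
      inSpan = spanClosed (A[W]-inSpan cong h) (A[W]-inSpan cong k)

  cocycle : FactorSet → Kernel
  cocycle (α , isFactorSet) h k = α h k , IsFactorSet.nonzero isFactorSet h k

  cocycle-isCocycle : ∀ α → IsCocycle (cocycle α)
  cocycle-isCocycle (α , isFactorSet) = record
    { cong    = λ p q → ⟨ IsFactorSet.cong isFactorSet p q ⟩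
    ; cocycle = λ h k l → ⟨ IsFactorSet.cocycle isFactorSet h k l ⟩
    }

  cocycle-cong : ∀ α → Congruent₂ (cocycle α)
  cocycle-cong α = IsCocycle.cong (cocycle-isCocycle α)

  factorSet : ∀ {α} → IsCocycle α → FactorSet
  factorSet {α} isCocycle = matrix α , record
    { cong    = λ p q → ≈-number (IsCocycle.cong isCocycle p q)
    ; nonzero = λ h k → nonzero (α h k)
    ; cocycle = λ h k l → ≈-number (IsCocycle.cocycle isCocycle h k l)
    }

  W[]-isWeight : ∀ (α : FactorSet) → IsWeight W[ proj₁ α ] × NoZeroEntry W[ proj₁ α ]
  W[]-isWeight α =
      twisted⇒weight (cocycle-cong α) (⟨⟩-cong (cocycle-cong α)) (⟨⟩-twisted (cocycle-isCocycle α))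
    , λ x y → nonzero (K.⟨ cocycle α ⟩ x y)

  Φ : FactorSet → Weight
  Φ α = W[ proj₁ α ] , W[]-isWeight α

  ∼⇒≃ : ∀ W W′ → W ∼ W′ → kernel W ≃ kernel W′
  ∼⇒≃ W W′ = ≈ᵂ⇒≃ {kernel W} {kernel W′} (kernel-cong W)

  ≃⇒∼ : ∀ W W′ → kernel W ≃ kernel W′ → W ∼ W′
  ≃⇒∼ W W′ = ≃⇒≈ᵂ {kernel W} {kernel W′} (kernel-cong W)

  ∼-isEquivalence : IsEquivalence _∼_
  ∼-isEquivalence = record
    { refl  = λ {W} → ≃⇒∼ W W (≃-refl (kernel-cong W))
    ; sym   = λ {W} {W′} p → ≃⇒∼ W′ W (≃-sym (kernel-cong W) (∼⇒≃ W W′ p))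
    ; trans = λ {W} {W′} {W″} p q → ≃⇒∼ W W″ (≃-trans (kernel-cong W) (∼⇒≃ W W′ p) (∼⇒≃ W′ W″ q))
    }

  Φ-cong : ∀ {α β} → α ∼² β → Φ α ∼ Φ β
  Φ-cong {α} {β} (γ , β≈) = ≃⇒≈ᵂ (⟨⟩-cong (cocycle-cong α))
    (coboundary⇒≃ {cocycle α} {cocycle β} (cocycle-cong α) (toFunction γ) (λ h k → ⟨ β≈ h k ⟩))

  Φ-injective : ∀ {α β} → Φ α ∼ Φ β → α ∼² β
  Φ-injective {α} {β} Φα∼Φβ = fromFunction (_≃_.γ Vα≃Vβ)
    , λ h k → ≈-number (≃⇒coboundary (cocycle-isCocycle α) (cocycle-isCocycle β) Vα≃Vβ h k)
    where
    Vα≃Vβ : K.⟨ cocycle α ⟩ ≃ K.⟨ cocycle β ⟩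
    Vα≃Vβ = ≈ᵂ⇒≃ (⟨⟩-cong (cocycle-cong α)) Φα∼Φβ

  Φ-surjective : ∀ W → ∃[ α ] Φ α ∼ W
  Φ-surjective W = factorSet (twisted⇒cocycle {multiplier V} {V} α-cong (weight⇒twisted W))
    , ≃⇒≈ᵂ {K.⟨ multiplier V ⟩} {V} (⟨⟩-cong {multiplier V} α-cong)
        (twisted⇒≃⟨⟩ {multiplier V} {V} α-cong (kernel-cong W) (weight⇒twisted W))
    where
    V = kernel W
    α-cong : Congruent₂ (multiplier V)
    α-cong = multiplier-cong {V} (kernel-cong W)

  Ψ-isUnitary : ∀ W → IsUnitary (kernel (Ψ W))
  Ψ-isUnitary (W , isHWeight , W≉0) = record
    { unimodular = λ x y → norm≈ε x y (modulus x y)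
    ; diagonal   = λ x → ⟨ diagonal₁ x ⟩
    ; hermitian  = λ x y → ⟨ ≈-trans (*-congˡ (hermitian x y)) (≈-trans (conj-* (W x y))
        (≈-value (norm≈ε x y (modulus x y)) , ℝ.refl)) ⟩
    }
    where
    open IsHWeight isHWeight
    open OrderedField ℝ using (≈-value)
    norm≈ε : ∀ x y → HasModulus (W x y) ℝ.0# ⊎ HasModulus (W x y) ℝ.1# → norm (W x y , W≉0 x y) ℝ₊.≈ ℝ₊.ε
    norm≈ε x y (inj₁ (_ , 0²≈n)) = ⊥-elim (OrderedField.<⇒≉ ℝ (normSq-positive (W≉0 x y)) (ℝ.trans (ℝ.sym 0²≈n) (ℝ.zeroˡ ℝ.0#)))
    norm≈ε x y (inj₂ modulus₁)   = modulus₁⇒norm (W x y , W≉0 x y) modulus₁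

  unitary⇒HWeight : ∀ {V} → IsUnitary V → IsWeight (matrix V) → IsHWeight (matrix V)
  unitary⇒HWeight {V} isUnitary isWeight = record
    { isWeight  = isWeight
    ; hermitian = λ x y → begin
        W y x                             ≈⟨ *-identityʳ _ ⟨
        W y x * 1ℂ                        ≈⟨ *-congˡ (≈-trans (conj-* (W x y)) (≈-value (unimodular x y) , ℝ.refl)) ⟨
        W y x * (W x y * conj (W x y))    ≈⟨ *-assoc _ _ _ ⟨
        W y x * W x y * conj (W x y)      ≈⟨ *-congʳ (≈-number (hermitian y x)) ⟩
        1ℂ * conj (W x y)                 ≈⟨ *-identityˡ _ ⟩
        conj (W x y)                      ∎
    ; modulus   = λ x y → inj₂ (norm⇒modulus₁ (V x y) (unimodular x y))
    ; diagonal₁ = λ x → ≈-number (diagonal x)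
    }
    where
    open IsUnitary isUnitary
    open OrderedField ℝ using (≈-value)
    open SetoidReasoning ℂ-setoid
    W = matrix V

  Ψ-cong : ∀ {W W′} → W ∼ᴴ W′ → Ψ W ∼ Ψ W′
  Ψ-cong (a , γ , σ , σ-auto , eq , _) = a , γ , σ , σ-auto , eq

  Ψ-injective : ∀ {W W′} → Ψ W ∼ Ψ W′ → W ∼ᴴ W′
  Ψ-injective {W} {W′} ΨW∼ΨW′ = ≃ᵁ⇒≈ᴴ {kernel (Ψ W)} {kernel (Ψ W′)} (kernel-cong (Ψ W))
    (≃⇒≃ᵁ (Ψ-isUnitary W) (Ψ-isUnitary W′) (∼⇒≃ (Ψ W) (Ψ W′) ΨW∼ΨW′))

  Ψ-surjective : ∀ W → ∃[ U ] Ψ U ∼ W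
  Ψ-surjective W = (matrix V₂ , unitary⇒HWeight (proj₂ second) V₂-isWeight , λ x y → nonzero (V₂ x y))
    , ≃⇒≈ᵂ V₂-cong (≃-sym V-cong (≃-trans V-cong (≃-gauge b γ V-cong) (≃-gauge unit γ₂ V₁-cong)))
    where
    α = multiplier (kernel W)
    α-cong = multiplier-cong {kernel W} (kernel-cong W)
    V = kernel W
    V-cong = kernel-cong W
    first = ∃-unimodular α-cong V-cong (weight⇒twisted W)
    b = proj₁ first
    γ = proj₁ (proj₂ first)
    V₁ : Kernel
    V₁ = gauge b γ V
    V₁-cong : Congruent₂ V₁
    V₁-cong = gauge-cong b γ V-cong
    α₁-cong : Congruent₂ (coboundary γ α)
    α₁-cong = coboundary-cong γ {α} α-cong
    V₁-twisted : TwistedBy (coboundary γ α) V₁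
    V₁-twisted = gauge-twisted b γ {α} {V} (weight⇒twisted W)
    second = ∃-unitary α₁-cong V₁-twisted (proj₂ (proj₂ first))
    γ₂ = proj₁ second
    V₂ : Kernel
    V₂ = gauge unit γ₂ V₁
    V₂-cong : Congruent₂ V₂
    V₂-cong = gauge-cong unit γ₂ V₁-cong
    V₂-isWeight : IsWeight (matrix V₂)
    V₂-isWeight = twisted⇒weight (coboundary-cong γ₂ {coboundary γ α} α₁-cong) V₂-cong (gauge-twisted unit γ₂ {coboundary γ α} {V₁} V₁-twisted)

-- Since f reflects the relation, the domain inherits the equivalence laws from the codomain.
bijection : ∀ {a b ℓ₁ ℓ₂} {A : Set a} {B : Set b} {_≈₁_ : Rel A ℓ₁} {_≈₂_ : Rel B ℓ₂} {f : A → B} →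
            IsEquivalence _≈₂_ → (∀ {x y} → x ≈₁ y → f x ≈₂ f y) → (∀ {x y} → f x ≈₂ f y → x ≈₁ y) →
            (∀ y → ∃[ x ] f x ≈₂ y) → IsBijection _≈₁_ _≈₂_ f
bijection isEquivalence cong injective surjective = record
  { isInjection = record
    { isCongruent = record
      { cong           = cong
      ; isEquivalence₁ = record
        { refl  = injective E.refl
        ; sym   = λ p → injective (E.sym (cong p))
        ; trans = λ p q → injective (E.trans (cong p) (cong q))
        }
      ; isEquivalence₂ = isEquivalence
      }
    ; injective = injective
    }
  ; surjective = λ y → proj₁ (surjective y) , λ z≈x → E.trans (cong z≈x) (proj₂ (surjective y))
  }
  where module E = IsEquivalence isEquivalence

theorem3p3 : ∀ {r ℓr₁ ℓr₂ g ℓg} (ℝ : CompleteOrderedField r ℓr₁ ℓr₂) (𝔾 : FiniteGroup g ℓg) →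
    let open ThinConfiguration ℝ 𝔾 in
    (Σ[ isWeight ∈ (∀ (α : FactorSet) → IsWeight W[ proj₁ α ] × NoZeroEntry W[ proj₁ α ]) ]
    IsBijection _∼²_ _∼_ (λ α → W[ proj₁ α ] , isWeight α))
    × IsBijection _∼ᴴ_ _∼_ Ψ
theorem3p3 ℝ 𝔾 =
    (W[]-isWeight , bijection ∼-isEquivalence (λ {α} {β} → Φ-cong {α} {β}) (λ {α} {β} → Φ-injective {α} {β}) Φ-surjective)
  , bijection ∼-isEquivalence (λ {W} {W′} → Ψ-cong {W} {W′}) (λ {W} {W′} → Ψ-injective {W} {W′}) Ψ-surjective
  where open Weights ℝ 𝔾
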